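{- Let $p$ be an odd prime and let $\alpha,\beta\in\mathbb{Q}_p$ be algebraically dependent; let $F(X,Y)\in\mathbb{Q}[X,Y]$ be a non-zero polynomial of minimum total degree $D$ such that $F(\alpha,\beta)=0$. Suppose the $p$-adic MCF expansion $[(a_0,a_1,\ldots),(b_0,b_1,\ldots)]$ of $(\alpha,\beta)$ satisfies, for all sufficiently large $n$, \[k_{n+1}\geq(D-1)(k_n+k_{n-1})+2D\quad\text{and}\quad h_{n+1}\geq(D-1)k_n+D.\] Then $F(Q_n^\alpha,Q_n^\beta)=0$ for all sufficiently large $n$.
   Context: $\nu_p$ denotes the $p$-adic valuation. Browkin's $s$-function $s:\mathbb{Q}_p\to\mathbb{Z}[1/p]\cap(-p/2,p/2)$ is $s(\alpha)=\sum_{j=k}^{0}x_jp^j$ where $\alpha=\sum_{j=k}^\infty x_jp^j$, $x_j\in\mathbb{Z}\cap(-p/2,p/2)$ (empty sum $=0$ if $k>0$). The $p$-adic Jacobi–Perron algorithm applied to $(\alpha,\beta)$: $\alpha_0=\alpha,\beta_0=\beta$, and for $k\geq0$: $a_k=s(\alpha_k)$, $b_k=s(\beta_k)$, and if $\beta_k\neq b_k$, $\alpha_{k+1}=1/(\beta_k-b_k)$, $\beta_{k+1}=(\alpha_k-a_k)/(\beta_k-b_k)$; if $\beta_k=b_k$ it stops. Define $A_{ -2}=0,A_{ -1}=1,A_0=a_0$; $B_{ -2}=1,B_{ -1}=0,B_0=b_0$; $C_{ -2}=0,C_{ -1}=0,C_0=1$, and for $n\geq1$: $X_n=a_nX_{n-1}+b_nX_{n-2}+X_{n-3}$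 for $X\in\{A,B,C\}$; $Q_n^\alpha=A_n/C_n$, $Q_n^\beta=B_n/C_n$. For $n\geq1$: $k_n=\nu_p(1/a_n)$, $h_n=\nu_p(b_n/a_n)$ ($=+\infty$ if $b_n=0$). -}

module Defs where

open import Data.Nat as ℕ using (ℕ; zero; suc; _≤_)
open import Data.Nat.Divisibility using (_∣?_)
open import Data.Nat.DivMod using (_/_)
open import Data.Integer as ℤ using (ℤ; +_)
open import Data.Rational as ℚ using (ℚ; 0ℚ; 1ℚ; ↥_; ↧ₙ_)
open import Data.Rational.Properties using (_≟_)
open import Data.Fin using (Fin; toℕ)
open import Data.Product using (Σ; ∃; _×_; _,_)
open import Data.Sum using (_⊎_)
open import Relation.Nullary using (¬_; yes; no)
open import Relation.Binary.PropositionalEquality using (_≡_)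

-- total reciprocal on ℚ (value 0 at 0; only used at nonzero arguments)
inv : ℚ → ℚ
inv q with q ≟ 0ℚ
... | yes _ = 0ℚ
... | no q≢0 = ℚ.1/_ q {{ℚ.≢-nonZero q≢0}}

pow : ℚ → ℕ → ℚ
pow q zero = 1ℚ
pow q (suc n) = q ℚ.* pow q n

sumTo : ℕ → (ℕ → ℚ) → ℚ
sumTo zero f = f 0
sumTo (suc n) f = sumTo n f ℚ.+ f (suc n)

sumFin : (n : ℕ) → (Fin n → ℚ) → ℚ
sumFin zero f = 0ℚ
sumFin (suc n) f = f Fin.zero ℚ.+ sumFin n (λ i → f (Fin.suc i))

-- multiplicity of p in n, with fuel (fuel n suffices since p ≥ 2)
mult : ℕ → ℕ → ℕ → ℕ
mult zero p n = 0
mult (suc f) (suc (suc q)) (suc m) with suc (suc q) ∣? suc m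
... | yes _ = suc (mult f (suc (suc q)) (suc m / suc (suc q)))
... | no _ = 0
mult (suc f) _ _ = 0

νℕ : ℕ → ℕ → ℕ
νℕ p n = mult n p n

-- ν_p on ℚ (value at 0 is irrelevant: 0 is treated separately, ν_p(0) = +∞)
νℚ : ℕ → ℚ → ℤ
νℚ p q = (+ νℕ p ℤ.∣ ↥ q ∣) ℤ.- (+ νℕ p (↧ₙ q))

-- ν_p(q) ≥ N   (true for q = 0 since ν_p(0) = +∞)
ValGe : ℕ → ℚ → ℤ → Set
ValGe p q N = q ≡ 0ℚ ⊎ N ℤ.≤ νℚ p q

-- ℚ_p as the completion of ℚ: p-adic Cauchy sequences of rationals

Seq : Set
Seq = ℕ → ℚ

IsCauchy : ℕ → Seq → Set
IsCauchy p x = ∀ (N : ℕ) → ∃ λ M → ∀ m n → M ≤ m → M ≤ n →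
  ValGe p (x m ℚ.- x n) (+ N)

_≈[_]_ : Seq → ℕ → Seq → Set
x ≈[ p ] y = ∀ (N : ℕ) → ∃ λ M → ∀ n → M ≤ n → ValGe p (x n ℚ.- y n) (+ N)

νGe : ℕ → Seq → ℤ → Set
νGe p x K = ∃ λ M → ∀ n → M ≤ n → ValGe p (x n) K

const : ℚ → Seq
const q _ = q

_⊖_ : Seq → Seq → Seq
(x ⊖ y) n = x n ℚ.- y n

_⊗_ : Seq → Seq → Seq
(x ⊗ y) n = x n ℚ.* y n

invS : Seq → Seq
invS x n = inv (x n)

-- Browkin's s-function, as a relation  s(α) = a

Balanced : ℕ → ℤ → Set
Balanced p x = ℤ.- (+ p) ℤ.< (+ 2) ℤ.* x × (+ 2) ℤ.* x ℤ.< + p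

digitSum : ℕ → (m : ℕ) → (Fin (suc m) → ℤ) → ℚ
digitSum p m d = sumFin (suc m) (λ i → (d i ℚ./ 1) ℚ.* pow (inv (+ p ℚ./ 1)) (toℕ i))

-- s(α) = a : a = Σ_{j=k}^{0} x_j p^j with balanced digits x_j, where
-- α - a = Σ_{j≥1} x_j p^j, i.e. ν_p(α - a) ≥ 1
IsS : ℕ → Seq → ℚ → Set
IsS p α a = Σ ℕ λ m → Σ (Fin (suc m) → ℤ) λ d →
  (∀ i → Balanced p (d i)) × a ≡ digitSum p m d × νGe p (α ⊖ const a) (+ 1)

-- the p-adic Jacobi–Perron algorithm (infinite expansion)

record IsMCF (p : ℕ) (α β : Seq) (a b : ℕ → ℚ) (αs βs : ℕ → Seq) : Set where
  field
    init-α : αs 0 ≈[ p ] α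
    init-β : βs 0 ≈[ p ] β
    a-s    : ∀ k → IsS p (αs k) (a k)
    b-s    : ∀ k → IsS p (βs k) (b k)
    nonstop : ∀ k → ¬ (βs k ≈[ p ] const (b k))
    step-α : ∀ k → αs (suc k) ≈[ p ] invS (βs k ⊖ const (b k))
    step-β : ∀ k → βs (suc k) ≈[ p ] ((αs k ⊖ const (a k)) ⊗ invS (βs k ⊖ const (b k)))

kk : ℕ → (ℕ → ℚ) → ℕ → ℤ
kk p a n = νℚ p (inv (a n))

-- convergents: X_n = a_n X_{n-1} + b_n X_{n-2} + X_{n-3}

-- triple (X_{n-2}, X_{n-1}, X_n)
trip : ℚ → ℚ → ℚ → (ℕ → ℚ) → (ℕ → ℚ) → ℕ → ℚ × ℚ × ℚ
trip x₂ x₁ x₀ a b zero = x₂ , x₁ , x₀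
trip x₂ x₁ x₀ a b (suc n) with trip x₂ x₁ x₀ a b n
... | (u , v , w) = v , w , (a (suc n) ℚ.* w ℚ.+ b (suc n) ℚ.* v ℚ.+ u)

third : ℚ × ℚ × ℚ → ℚ
third (_ , _ , w) = w

Aₙ Bₙ Cₙ : (ℕ → ℚ) → (ℕ → ℚ) → ℕ → ℚ
Aₙ a b n = third (trip 0ℚ 1ℚ (a 0) a b n)
Bₙ a b n = third (trip 1ℚ 0ℚ (b 0) a b n)
Cₙ a b n = third (trip 0ℚ 0ℚ 1ℚ a b n)

Qα Qβ : (ℕ → ℚ) → (ℕ → ℚ) → ℕ → ℚ
Qα a b n = Aₙ a b n ℚ.* inv (Cₙ a b n)
Qβ a b n = Bₙ a b n ℚ.* inv (Cₙ a b n)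

record Poly : Set where
  field
    bound   : ℕ
    coeff   : ℕ → ℕ → ℚ
    support : ∀ i j → bound ℕ.< i ℕ.+ j → coeff i j ≡ 0ℚ
open Poly public

NonZeroPoly : Poly → Set
NonZeroPoly F = ∃ λ i → ∃ λ j → ¬ (coeff F i j ≡ 0ℚ)

TotalDegree : Poly → ℕ → Set
TotalDegree F D =
  (∃ λ i → ∃ λ j → i ℕ.+ j ≡ D × ¬ (coeff F i j ≡ 0ℚ)) ×
  (∀ i j → ¬ (coeff F i j ≡ 0ℚ) → i ℕ.+ j ≤ D)

evalℚ : Poly → ℚ → ℚ → ℚ
evalℚ F x y = sumTo (bound F) λ i → sumTo (bound F) λ j →
  coeff F i j ℚ.* pow x i ℚ.* pow y j

evalSeq : Poly → Seq → Seq → Seq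
evalSeq F x y n = evalℚ F (x n) (y n)

{-# OPTIONS --safe #-}

-- Write D for the degree and K_n = k_1 + ⋯ + k_n. The errors V_n = A_n − α C_n satisfy
-- V_n + (α_n − a_n) V_{n−1} + (β_n − b_n) V_{n−2} = 0, so the growth hypotheses give, by
-- induction, ν(V_n) ≥ (D−1) K_n + D n − O(1); likewise for B_n − β C_n. As ν(C_n) = −K_n, the
-- number C_n^D F(A_n/C_n, B_n/C_n) is p-adically close to C_n^D F(α, β) = 0: its valuation is at
-- least D n − O(1). Up to a fixed denominator it lies in ℤ[1/p], so if it is non-zero its absolute
-- value is at least p^(D n − O(1)). But |a_n|, |b_n| ≤ p/2 bound the convergents by O(λ^n) with
-- λ = p − 1/2, so the absolute value is O(λ^(D n)), which is impossible for large n.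
--
-- Points of ℚ_p are sequences of rationals, so identities between them hold up to sequences
-- of eventually arbitrarily large valuation. Where the algorithm does not stop, the valuation of
-- β_k − b_k is read off a_{k+1}; this avoids Markov's principle.
module Submission where

open import Defs
open import Data.Nat as ℕ using (ℕ; zero; suc; _≤_)
import Data.Nat.Properties as ℕ
import Data.Nat.Divisibility as ℕ
open import Data.Nat.Coprimality using (1-coprimeTo) renaming (sym to coprime-sym)
open import Data.Nat.DivMod using (_/_; m*[n/m]≡n; m/n<m)
open import Data.Nat.Primality using (Prime; euclidsLemma; prime⇒nonZero; prime⇒nonTrivial)
open import Data.Integer as ℤ using (ℤ; +_; -[1+_]; 0ℤ; 1ℤ)
import Data.Integer.Properties as ℤ
open import Data.Integer.Divisibility.Signed as ℤ using (divides)
import Data.Integer.Tactic.RingSolver as ℤ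
open import Data.Rational as ℚ using (ℚ; mkℚ; 0ℚ; 1ℚ; ½; ↥_; ↧_)
import Data.Rational.Properties as ℚ
import Data.Rational.Unnormalised as ℚᵘ
open import Data.Fin as Fin using (Fin; toℕ)
open import Data.Product using (∃; _×_; _,_; proj₁; proj₂)
open import Data.Sum using (_⊎_; inj₁; inj₂; [_,_]′)
open import Data.Empty using (⊥-elim)
open import Function using (_∘_)
open import Level using (0ℓ)
open import Relation.Nullary using (¬_; yes; no)
open import Relation.Nullary.Decidable using (dec⇒maybe; decidable-stable)
open import Relation.Binary.PropositionalEquality
open import Tactic.RingSolver using (solve-∀)
open import Tactic.RingSolver.Core.AlmostCommutativeRing using (AlmostCommutativeRing; fromCommutativeRing)

-- The shape of the error bound comes from homogenisation. In a difference of two monomials of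
-- degree D, one factor is replaced by its error while the other D - 1 keep a valuation of about
-- -K_n. The part (D-1) K_n of the bound is therefore used up exactly, and D n survives. The size
-- bound λ^(D n) carries the same exponent D n, so the comparison is decided by λ < p alone. Degree
-- 0 is treated apart: there F is constant, and D - 1 is not a natural number.

ℚ-ring : AlmostCommutativeRing 0ℓ 0ℓ
ℚ-ring = fromCommutativeRing ℚ.+-*-commutativeRing (λ x → dec⇒maybe (0ℚ ℚ.≟ x))

-- Rational arithmetic

ι : ℤ → ℚ
ι m = m ℚ./ 1

private
  -- For a variable `m` the term `m ℚ./ 1` is blocked by gcd normalisation. This normal form lets
  -- sums, products and comparisons of embedded integers compute.
  ι≡mkℚ : ∀ m → ι m ≡ mkℚ m 0 (coprime-sym (1-coprimeTo ℤ.∣ m ∣))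
  ι≡mkℚ m = ℚ.↥p/↧p≡p (mkℚ m 0 (coprime-sym (1-coprimeTo ℤ.∣ m ∣)))

ι-+ : ∀ m n → ι (m ℤ.+ n) ≡ ι m ℚ.+ ι n
ι-+ m n = sym (trans (cong₂ ℚ._+_ (ι≡mkℚ m) (ι≡mkℚ n))
  (cong ι (cong₂ ℤ._+_ (ℤ.*-identityʳ m) (ℤ.*-identityʳ n))))

ι-* : ∀ m n → ι (m ℤ.* n) ≡ ι m ℚ.* ι n
ι-* m n = sym (cong₂ ℚ._*_ (ι≡mkℚ m) (ι≡mkℚ n))

ι-injective : ∀ {m n} → ι m ≡ ι n → m ≡ n
ι-injective {m} {n} e = cong ↥_ (trans (sym (ι≡mkℚ m)) (trans e (ι≡mkℚ n)))

ι-mono-≤ : ∀ {m n} → m ℤ.≤ n → ι m ℚ.≤ ι n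
ι-mono-≤ {m} {n} m≤n = subst₂ ℚ._≤_ (sym (ι≡mkℚ m)) (sym (ι≡mkℚ n))
  (ℚ.*≤* (ℤ.*-monoʳ-≤-nonNeg 1ℤ m≤n))

ι-∣∣ : ∀ m → ℚ.∣ ι m ∣ ≡ ι (+ ℤ.∣ m ∣)
ι-∣∣ m = trans (cong ℚ.∣_∣ (ι≡mkℚ m)) (sym (ι≡mkℚ (+ ℤ.∣ m ∣)))

*-↧ : ∀ q → q ℚ.* ι (↧ q) ≡ ι (↥ q)
*-↧ q@(mkℚ m d c) = begin
  q ℚ.* ι (↧ q)                          ≡⟨ cong (q ℚ.*_) (ι≡mkℚ (↧ q)) ⟩
  (m ℤ.* + suc d) ℚ./ (suc d ℕ.* 1)       ≡⟨ ℚ.fromℚᵘ-cong {ℚᵘ.mkℚᵘ (m ℤ.* + suc d) (d ℕ.* 1)} {ℚᵘ.mkℚᵘ m 0} (ℚᵘ.*≡* eq) ⟩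
  ι m                                     ∎
  where
  open ≡-Reasoning
  eq : m ℤ.* + suc d ℤ.* 1ℤ ≡ m ℤ.* + suc (d ℕ.* 1)
  eq = trans (ℤ.*-identityʳ _) (cong (λ e → m ℤ.* + suc e) (sym (ℕ.*-identityʳ d)))

inv-inverseʳ : ∀ {q} → q ≢ 0ℚ → q ℚ.* inv q ≡ 1ℚ
inv-inverseʳ {q} q≢0 with q ℚ.≟ 0ℚ
... | yes q≡0 = ⊥-elim (q≢0 q≡0)
... | no  q≢0 = ℚ.*-inverseʳ q {{ℚ.≢-nonZero q≢0}}

*-cancelˡ-≢0 : ∀ {q x y} → q ≢ 0ℚ → q ℚ.* x ≡ q ℚ.* y → x ≡ y
*-cancelˡ-≢0 {q} {x} {y} q≢0 e = trans (lem x) (trans (cong (inv q ℚ.*_) e) (sym (lem y)))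
  where
  lem : ∀ z → z ≡ inv q ℚ.* (q ℚ.* z)
  lem z = trans (sym (ℚ.*-identityˡ z))
    (trans (cong (ℚ._* z) (sym (trans (ℚ.*-comm (inv q) q) (inv-inverseʳ q≢0)))) (ℚ.*-assoc (inv q) q z))

*≢0 : ∀ {x y} → x ≢ 0ℚ → y ≢ 0ℚ → x ℚ.* y ≢ 0ℚ
*≢0 {x} x≢0 y≢0 e = y≢0 (*-cancelˡ-≢0 x≢0 (trans e (sym (ℚ.*-zeroʳ x))))

inv-unique : ∀ {x y} → x ℚ.* y ≡ 1ℚ → inv x ≡ y
inv-unique {x} {y} e = *-cancelˡ-≢0 x≢0 (trans (inv-inverseʳ x≢0) (sym e))
  where
  x≢0 : x ≢ 0ℚ
  x≢0 refl = ℚ.1≢0 (trans (sym e) (ℚ.*-zeroˡ y))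

*-interchange : ∀ x y u v → x ℚ.* y ℚ.* (u ℚ.* v) ≡ x ℚ.* u ℚ.* (y ℚ.* v)
*-interchange = solve-∀ ℚ-ring

pow-+ : ∀ q m n → pow q (m ℕ.+ n) ≡ pow q m ℚ.* pow q n
pow-+ q zero    n = sym (ℚ.*-identityˡ (pow q n))
pow-+ q (suc m) n = trans (cong (q ℚ.*_) (pow-+ q m n)) (sym (ℚ.*-assoc q (pow q m) (pow q n)))

pow-* : ∀ x y n → pow (x ℚ.* y) n ≡ pow x n ℚ.* pow y n
pow-* x y zero    = refl
pow-* x y (suc n) = trans (cong (x ℚ.* y ℚ.*_) (pow-* x y n)) (*-interchange x y (pow x n) (pow y n))

pow-pow : ∀ x m n → pow (pow x n) m ≡ pow x (m ℕ.* n)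
pow-pow x zero    n = refl
pow-pow x (suc m) n = trans (cong (pow x n ℚ.*_) (pow-pow x m n)) (sym (pow-+ x n (m ℕ.* n)))

pow≢0 : ∀ {x} → x ≢ 0ℚ → ∀ n → pow x n ≢ 0ℚ
pow≢0 x≢0 zero    = ℚ.1≢0
pow≢0 x≢0 (suc n) = *≢0 x≢0 (pow≢0 x≢0 n)

≤-from-diff : ∀ {i j} d → 0ℤ ℤ.≤ d → j ≡ i ℤ.+ d → i ℤ.≤ j
≤-from-diff {i} d 0≤d refl = subst (ℤ._≤ i ℤ.+ d) (ℤ.+-identityʳ i) (ℤ.+-monoʳ-≤ i 0≤d)

i≤+∣i∣ : ∀ i → i ℤ.≤ + ℤ.∣ i ∣
i≤+∣i∣ (+ n)    = ℤ.≤-refl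
i≤+∣i∣ -[1+ n ] = ℤ.-≤+

-- Homogenisation

sumTo-cong : ∀ n {f g : ℕ → ℚ} → (∀ i → f i ≡ g i) → sumTo n f ≡ sumTo n g
sumTo-cong zero    e = e 0
sumTo-cong (suc n) e = cong₂ ℚ._+_ (sumTo-cong n e) (e (suc n))

*-sumTo : ∀ q n f → q ℚ.* sumTo n f ≡ sumTo n (λ i → q ℚ.* f i)
*-sumTo q zero    f = refl
*-sumTo q (suc n) f = trans (ℚ.*-distribˡ-+ q (sumTo n f) (f (suc n)))
  (cong (ℚ._+ q ℚ.* f (suc n)) (*-sumTo q n f))

-- The predicate is abstract because the lemma is applied twice, nested: to the coefficients of one
-- row, and then with "clears the whole row" as the predicate.
common-multiple : (Q : ℕ → ℤ → Set) → (∀ i {m} n → Q i m → Q i (m ℤ.* n)) →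
  (∀ i → ∃ λ m → m ≢ 0ℤ × Q i m) → ∀ n → ∃ λ m → m ≢ 0ℤ × (∀ i → i ≤ n → Q i m)
common-multiple Q Q-* Q-ex zero with Q-ex 0
... | m , m≢0 , q = m , m≢0 , λ { .0 ℕ.z≤n → q }
common-multiple Q Q-* Q-ex (suc n) with common-multiple Q Q-* Q-ex n | Q-ex (suc n)
... | m , m≢0 , q | m′ , m′≢0 , q′ = m ℤ.* m′ ,
  (λ e → [ m≢0 , m′≢0 ]′ (ℤ.i*j≡0⇒i≡0∨j≡0 m e)) ,
  λ i i≤1+n → [ (λ i<1+n → Q-* i m′ (q i (ℕ.≤-pred i<1+n)))
              , (λ { refl → subst (Q i) (ℤ.*-comm m′ m) (Q-* i m q′) }) ]′ (ℕ.m≤n⇒m<n∨m≡n i≤1+n)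

IsInteger : ℚ → Set
IsInteger x = ∃ λ m → x ≡ ι m

common-denominator : (F : Poly) → ∃ λ M → M ≢ 0ℤ × (∀ i j → IsInteger (ι M ℚ.* coeff F i j))
common-denominator F = proj₁ multiple , proj₁ (proj₂ multiple) , extend (proj₁ multiple) (proj₂ (proj₂ multiple))
  where
  scale : ∀ m n q → IsInteger (ι m ℚ.* q) → IsInteger (ι (m ℤ.* n) ℚ.* q)
  scale m n q (k , e) = n ℤ.* k , (begin
    ι (m ℤ.* n) ℚ.* q       ≡⟨ cong (ℚ._* q) (ι-* m n) ⟩
    ι m ℚ.* ι n ℚ.* q       ≡⟨ lem (ι m) (ι n) q ⟩
    ι n ℚ.* (ι m ℚ.* q)     ≡⟨ cong (ι n ℚ.*_) e ⟩
    ι n ℚ.* ι k             ≡⟨ ι-* n k ⟨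
    ι (n ℤ.* k)             ∎)
    where
    open ≡-Reasoning
    lem : ∀ m n q → m ℚ.* n ℚ.* q ≡ n ℚ.* (m ℚ.* q)
    lem = solve-∀ ℚ-ring

  Clears : ℕ → ℕ → ℤ → Set
  Clears i j m = IsInteger (ι m ℚ.* coeff F i j)

  clears-↧ : ∀ i j → ∃ λ m → m ≢ 0ℤ × Clears i j m
  clears-↧ i j = ↧ coeff F i j , (λ ()) , ↥ coeff F i j ,
    trans (ℚ.*-comm (ι (↧ coeff F i j)) (coeff F i j)) (*-↧ (coeff F i j))

  multiple : ∃ λ m → m ≢ 0ℤ × (∀ i → i ≤ bound F → ∀ j → j ≤ bound F → Clears i j m)
  multiple = common-multiple (λ i m → ∀ j → j ≤ bound F → Clears i j m)
    (λ i {m} n q j j≤B → scale m n (coeff F i j) (q j j≤B))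
    (λ i → common-multiple (Clears i) (λ j {m} n → scale m n (coeff F i j)) (clears-↧ i) (bound F))
    (bound F)

  extend : ∀ m → (∀ i → i ≤ bound F → ∀ j → j ≤ bound F → Clears i j m) → ∀ i j → Clears i j m
  extend m q i j with i ℕ.+ j ℕ.≤? bound F
  ... | yes i+j≤B = q i (ℕ.≤-trans (ℕ.m≤m+n i j) i+j≤B) j (ℕ.≤-trans (ℕ.m≤n+m j i) i+j≤B)
  ... | no  i+j≰B = 0ℤ , trans (cong (ι m ℚ.*_) (support F i j (ℕ.≰⇒> i+j≰B))) (ℚ.*-zeroʳ (ι m))

-- The form M z^D F(x/z, y/z).
module Homogenisation (F : Poly) (D : ℕ)
  (degree : ∀ i j → ¬ (coeff F i j ≡ 0ℚ) → i ℕ.+ j ≤ D) (M : ℤ) where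

  c : ℕ → ℕ → ℚ
  c i j = ι M ℚ.* coeff F i j

  monomial : ℚ → ℚ → ℚ → ℕ → ℕ → ℚ
  monomial x y z i j = pow x i ℚ.* pow y j ℚ.* pow z (D ℕ.∸ (i ℕ.+ j))

  H : ℚ → ℚ → ℚ → ℚ
  H x y z = sumTo (bound F) λ i → sumTo (bound F) λ j → c i j ℚ.* monomial x y z i j

  -- The sum in `H` runs over a full square, where `i + j` may exceed `D` and the truncated
  -- subtraction then yields a wrong exponent. Exactly there the coefficient is zero.
  term-cases : ∀ i j → c i j ≡ 0ℚ ⊎ i ℕ.+ j ℕ.+ (D ℕ.∸ (i ℕ.+ j)) ≡ D
  term-cases i j with coeff F i j ℚ.≟ 0ℚ
  ... | yes e = inj₁ (trans (cong (ι M ℚ.*_) e) (ℚ.*-zeroʳ (ι M)))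
  ... | no ne = inj₂ (ℕ.m+[n∸m]≡n (degree i j ne))

  -- Free of division, so that with `z = C n` it serves both for the approximations of (α, β) and
  -- for the convergents.
  H-homogeneous : ∀ z x y → H (z ℚ.* x) (z ℚ.* y) z ≡ ι M ℚ.* pow z D ℚ.* evalℚ F x y
  H-homogeneous z x y = sym (trans (*-sumTo k (bound F) _) (sumTo-cong (bound F) λ i →
      trans (*-sumTo k (bound F) _) (sumTo-cong (bound F) (term i))))
    where
    open ≡-Reasoning
    k = ι M ℚ.* pow z D
    lem₁ : ∀ M w f x y → M ℚ.* w ℚ.* (f ℚ.* x ℚ.* y) ≡ M ℚ.* f ℚ.* (w ℚ.* x ℚ.* y)
    lem₁ = solve-∀ ℚ-ring
    lem₂ : ∀ a b c x y → a ℚ.* b ℚ.* c ℚ.* x ℚ.* y ≡ a ℚ.* x ℚ.* (b ℚ.* y) ℚ.* c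
    lem₂ = solve-∀ ℚ-ring
    term : ∀ i j → k ℚ.* (coeff F i j ℚ.* pow x i ℚ.* pow y j) ≡ c i j ℚ.* monomial (z ℚ.* x) (z ℚ.* y) z i j
    term i j = trans (lem₁ (ι M) (pow z D) (coeff F i j) (pow x i) (pow y j)) (cases (term-cases i j))
      where
      cases : c i j ≡ 0ℚ ⊎ i ℕ.+ j ℕ.+ (D ℕ.∸ (i ℕ.+ j)) ≡ D →
        c i j ℚ.* (pow z D ℚ.* pow x i ℚ.* pow y j) ≡ c i j ℚ.* monomial (z ℚ.* x) (z ℚ.* y) z i j
      cases (inj₁ e) = trans (cong (ℚ._* (pow z D ℚ.* pow x i ℚ.* pow y j)) e)
        (trans (ℚ.*-zeroˡ (pow z D ℚ.* pow x i ℚ.* pow y j))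
          (sym (trans (cong (ℚ._* monomial (z ℚ.* x) (z ℚ.* y) z i j) e)
            (ℚ.*-zeroˡ (monomial (z ℚ.* x) (z ℚ.* y) z i j)))))
      cases (inj₂ e) = cong (c i j ℚ.*_) (begin
        pow z D ℚ.* pow x i ℚ.* pow y j
          ≡⟨ cong (λ n → pow z n ℚ.* pow x i ℚ.* pow y j) e ⟨
        pow z (i ℕ.+ j ℕ.+ r) ℚ.* pow x i ℚ.* pow y j
          ≡⟨ cong (λ w → w ℚ.* pow x i ℚ.* pow y j)
               (trans (pow-+ z (i ℕ.+ j) r) (cong (ℚ._* pow z r) (pow-+ z i j))) ⟩
        pow z i ℚ.* pow z j ℚ.* pow z r ℚ.* pow x i ℚ.* pow y j
          ≡⟨ lem₂ (pow z i) (pow z j) (pow z r) (pow x i) (pow y j) ⟩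
        pow z i ℚ.* pow x i ℚ.* (pow z j ℚ.* pow y j) ℚ.* pow z r
          ≡⟨ cong₂ (λ u v → u ℚ.* v ℚ.* pow z r) (pow-* z x i) (pow-* z y j) ⟨
        monomial (z ℚ.* x) (z ℚ.* y) z i j ∎)
        where r = D ℕ.∸ (i ℕ.+ j)

evalℚ-constant : ∀ F → (∀ i j → ¬ (coeff F i j ≡ 0ℚ) → i ℕ.+ j ≤ 0) →
  ∀ x y x′ y′ → evalℚ F x y ≡ evalℚ F x′ y′
evalℚ-constant F degree x y x′ y′ =
  sumTo-cong (bound F) λ i → sumTo-cong (bound F) λ j → term i j
  where
  kill : ∀ {c} s t → c ≡ 0ℚ → c ℚ.* s ℚ.* t ≡ 0ℚ
  kill s t refl = trans (cong (ℚ._* t) (ℚ.*-zeroˡ s)) (ℚ.*-zeroˡ t)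
  term : ∀ i j → coeff F i j ℚ.* pow x i ℚ.* pow y j ≡ coeff F i j ℚ.* pow x′ i ℚ.* pow y′ j
  term zero    zero    = refl
  term zero    (suc j) with coeff F zero (suc j) ℚ.≟ 0ℚ
  ... | yes e = trans (kill 1ℚ (pow y (suc j)) e) (sym (kill 1ℚ (pow y′ (suc j)) e))
  ... | no ne with degree zero (suc j) ne
  ...   | ()
  term (suc i) j with coeff F (suc i) j ℚ.≟ 0ℚ
  ... | yes e = trans (kill (pow x (suc i)) (pow y j) e) (sym (kill (pow x′ (suc i)) (pow y′ j) e))
  ... | no ne with degree (suc i) j ne
  ...   | ()

-- Archimedean estimates

0≤1 : 0ℚ ℚ.≤ 1ℚ
0≤1 = ℚ.nonNegative⁻¹ 1ℚ

1≰0 : ¬ (1ℚ ℚ.≤ 0ℚ)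
1≰0 (ℚ.*≤* (ℤ.+≤+ ()))

x≤x+y : ∀ x y → 0ℚ ℚ.≤ y → x ℚ.≤ x ℚ.+ y
x≤x+y x y 0≤y = subst (ℚ._≤ x ℚ.+ y) (ℚ.+-identityʳ x) (ℚ.+-monoʳ-≤ x 0≤y)

x≤y+x : ∀ x y → 0ℚ ℚ.≤ y → x ℚ.≤ y ℚ.+ x
x≤y+x x y 0≤y = subst (ℚ._≤ y ℚ.+ x) (ℚ.+-identityˡ x) (ℚ.+-monoˡ-≤ x 0≤y)

*-mono-≤-0≤ : ∀ {w x y z} → 0ℚ ℚ.≤ w → w ℚ.≤ x → 0ℚ ℚ.≤ y → y ℚ.≤ z → w ℚ.* y ℚ.≤ x ℚ.* z
*-mono-≤-0≤ {w} {x} {y} {z} 0≤w w≤x 0≤y y≤z = ℚ.≤-trans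
  (ℚ.*-monoʳ-≤-nonNeg y {{ℚ.nonNegative 0≤y}} w≤x)
  (ℚ.*-monoˡ-≤-nonNeg x {{ℚ.nonNegative (ℚ.≤-trans 0≤w w≤x)}} y≤z)

0≤* : ∀ {x y} → 0ℚ ℚ.≤ x → 0ℚ ℚ.≤ y → 0ℚ ℚ.≤ x ℚ.* y
0≤* 0≤x 0≤y = *-mono-≤-0≤ ℚ.≤-refl 0≤x ℚ.≤-refl 0≤y

0≤+ : ∀ {x y} → 0ℚ ℚ.≤ x → 0ℚ ℚ.≤ y → 0ℚ ℚ.≤ x ℚ.+ y
0≤+ 0≤x 0≤y = ℚ.+-mono-≤ 0≤x 0≤y

0≤pow : ∀ {x} → 0ℚ ℚ.≤ x → ∀ n → 0ℚ ℚ.≤ pow x n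
0≤pow 0≤x zero    = ι-mono-≤ (ℤ.+≤+ (ℕ.z≤n {1}))
0≤pow 0≤x (suc n) = 0≤* 0≤x (0≤pow 0≤x n)

∣pow∣≤ : ∀ {x y} → ℚ.∣ x ∣ ℚ.≤ y → ∀ n → ℚ.∣ pow x n ∣ ℚ.≤ pow y n
∣pow∣≤ x≤y zero = ℚ.≤-refl
∣pow∣≤ {x} {y} x≤y (suc n) = subst (ℚ._≤ y ℚ.* pow y n) (sym (ℚ.∣p*q∣≡∣p∣*∣q∣ x (pow x n)))
  (*-mono-≤-0≤ (ℚ.0≤∣p∣ x) x≤y (ℚ.0≤∣p∣ (pow x n)) (∣pow∣≤ x≤y n))

∣*∣≤ : ∀ {x y u v} → ℚ.∣ x ∣ ℚ.≤ u → ℚ.∣ y ∣ ℚ.≤ v → ℚ.∣ x ℚ.* y ∣ ℚ.≤ u ℚ.* v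
∣*∣≤ {x} {y} {u} {v} x≤u y≤v = subst (ℚ._≤ u ℚ.* v) (sym (ℚ.∣p*q∣≡∣p∣*∣q∣ x y))
  (*-mono-≤-0≤ (ℚ.0≤∣p∣ x) x≤u (ℚ.0≤∣p∣ y) y≤v)

∣+∣≤ : ∀ {x y u v} → ℚ.∣ x ∣ ℚ.≤ u → ℚ.∣ y ∣ ℚ.≤ v → ℚ.∣ x ℚ.+ y ∣ ℚ.≤ u ℚ.+ v
∣+∣≤ {x} {y} x≤u y≤v = ℚ.≤-trans (ℚ.∣p+q∣≤∣p∣+∣q∣ x y) (ℚ.+-mono-≤ x≤u y≤v)

∣sumTo∣≤ : ∀ n {f g : ℕ → ℚ} → (∀ i → ℚ.∣ f i ∣ ℚ.≤ g i) → ℚ.∣ sumTo n f ∣ ℚ.≤ sumTo n g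
∣sumTo∣≤ zero    h = h 0
∣sumTo∣≤ (suc n) h = ∣+∣≤ (∣sumTo∣≤ n h) (h (suc n))

-- A denominator is at least 1, so the numerator already bounds the fraction; multiplying by the
-- denominator leaves a claim about integers.
archimedean : ∀ q → q ℚ.≤ ι (+ ℤ.∣ ↥ q ∣)
archimedean q with ℤ.∣ ↥ q ∣ in e
archimedean q@(mkℚ m d c) | n = ℚ.*-cancelʳ-≤-pos (ι (+ suc d)) {{ℚ.normalize-pos (suc d) 1}}
  (subst₂ ℚ._≤_ (sym (*-↧ q)) (ι-* (+ n) (+ suc d)) (ι-mono-≤ (m≤ m e)))
  where
  m≤ : ∀ m → ℤ.∣ m ∣ ≡ n → m ℤ.≤ + n ℤ.* + suc d
  m≤ (+ k)    refl = subst (+ k ℤ.≤_) (ℤ.pos-* k (suc d)) (ℤ.+≤+ (ℕ.m≤m*n k (suc d)))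
  m≤ -[1+ k ] refl = ℤ.-≤+

-- Every monomial with a non-zero coefficient is a product of exactly D factors, each of size at
-- most `Λ`.
∣H∣≤ : ∀ F D degree M {x y z Λ} → let open Homogenisation F D degree M in
  ℚ.∣ x ∣ ℚ.≤ Λ → ℚ.∣ y ∣ ℚ.≤ Λ → ℚ.∣ z ∣ ℚ.≤ Λ →
  ℚ.∣ H x y z ∣ ℚ.≤ pow Λ D ℚ.* sumTo (bound F) (λ i → sumTo (bound F) λ j → ℚ.∣ c i j ∣)
∣H∣≤ F D degree M {x} {y} {z} {Λ} x≤ y≤ z≤ =
  subst (ℚ.∣ H x y z ∣ ℚ.≤_)
    (sym (trans (*-sumTo (pow Λ D) (bound F) _) (sumTo-cong (bound F) λ i → *-sumTo (pow Λ D) (bound F) _)))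
    (∣sumTo∣≤ (bound F) λ i → ∣sumTo∣≤ (bound F) λ j → term i j (term-cases i j))
  where
  open Homogenisation F D degree M
  0≤Λ^D : 0ℚ ℚ.≤ pow Λ D
  0≤Λ^D = 0≤pow (ℚ.≤-trans (ℚ.0≤∣p∣ x) x≤) D
  term : ∀ i j → c i j ≡ 0ℚ ⊎ i ℕ.+ j ℕ.+ (D ℕ.∸ (i ℕ.+ j)) ≡ D →
    ℚ.∣ c i j ℚ.* monomial x y z i j ∣ ℚ.≤ pow Λ D ℚ.* ℚ.∣ c i j ∣
  term i j (inj₁ e) = subst (ℚ._≤ pow Λ D ℚ.* ℚ.∣ c i j ∣)
    (sym (cong ℚ.∣_∣ (trans (cong (ℚ._* monomial x y z i j) e) (ℚ.*-zeroˡ (monomial x y z i j)))))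
    (0≤* 0≤Λ^D (ℚ.0≤∣p∣ (c i j)))
  term i j (inj₂ e) = subst (ℚ.∣ c i j ℚ.* monomial x y z i j ∣ ℚ.≤_) (ℚ.*-comm ℚ.∣ c i j ∣ (pow Λ D))
    (∣*∣≤ {c i j} {monomial x y z i j} ℚ.≤-refl (subst (ℚ.∣ monomial x y z i j ∣ ℚ.≤_) Λ-eq
      (∣*∣≤ {pow x i ℚ.* pow y j} {pow z r} (∣*∣≤ {pow x i} {pow y j} (∣pow∣≤ x≤ i) (∣pow∣≤ y≤ j)) (∣pow∣≤ z≤ r))))
    where
    r = D ℕ.∸ (i ℕ.+ j)
    Λ-eq : pow Λ i ℚ.* pow Λ j ℚ.* pow Λ r ≡ pow Λ D
    Λ-eq = trans (cong (ℚ._* pow Λ r) (sym (pow-+ Λ i j)))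
      (trans (sym (pow-+ Λ (i ℕ.+ j) r)) (cong (pow Λ) e))

first second : ℚ × ℚ × ℚ → ℚ
first  (u , _ , _) = u
second (_ , v , _) = v

-- Valuations

module Valuation (p : ℕ) (pr : Prime p) where

  private instance
    p-nonZero = prime⇒nonZero pr

  P : ℚ
  P = ι (+ p)

  p∤1 : ¬ (+ p ℤ.∣ 1ℤ)
  p∤1 p∣1 = ℕ.>⇒∤ (ℕ.nonTrivial⇒n>1 p {{prime⇒nonTrivial pr}}) (ℤ.∣⇒∣ᵤ p∣1)

  p∤* : ∀ {m n} → ¬ (+ p ℤ.∣ m) → ¬ (+ p ℤ.∣ n) → ¬ (+ p ℤ.∣ m ℤ.* n)
  p∤* {m} {n} p∤m p∤n p∣mn =
    [ p∤m ∘ ℤ.∣ᵤ⇒∣ , p∤n ∘ ℤ.∣ᵤ⇒∣ ]′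
    (euclidsLemma ℤ.∣ m ∣ ℤ.∣ n ∣ pr (subst (p ℕ.∣_) (ℤ.abs-* m n) (ℤ.∣⇒∣ᵤ p∣mn)))

  P≢0 : P ≢ 0ℚ
  P≢0 e = ℕ.≢-nonZero⁻¹ p (ℤ.+-injective (ι-injective e))

  -- membership in the localisation ℤ₍ₚ₎
  record Integral (x : ℚ) : Set where
    constructor integral
    field
      num den : ℤ
      p∤den   : ¬ (+ p ℤ.∣ den)
      eq      : x ℚ.* ι den ≡ ι num

  record Unit (x : ℚ) : Set where
    constructor unit
    field
      num den : ℤ
      p∤num   : ¬ (+ p ℤ.∣ num)
      p∤den   : ¬ (+ p ℤ.∣ den)
      eq      : x ℚ.* ι den ≡ ι num

  Unit⇒Integral : ∀ {x} → Unit x → Integral x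
  Unit⇒Integral (unit m s _ p∤s e) = integral m s p∤s e

  Integral-ι : ∀ m → Integral (ι m)
  Integral-ι m = integral m 1ℤ p∤1 (ℚ.*-identityʳ (ι m))

  Unit-1 : Unit 1ℚ
  Unit-1 = unit 1ℤ 1ℤ p∤1 p∤1 refl

  private
    sum-eq : ∀ x y m s n t → x ℚ.* ι s ≡ ι m → y ℚ.* ι t ≡ ι n →
      (x ℚ.+ y) ℚ.* ι (s ℤ.* t) ≡ ι (m ℤ.* t ℤ.+ n ℤ.* s)
    sum-eq x y m s n t e f = begin
      (x ℚ.+ y) ℚ.* ι (s ℤ.* t)       ≡⟨ cong ((x ℚ.+ y) ℚ.*_) (ι-* s t) ⟩
      (x ℚ.+ y) ℚ.* (ι s ℚ.* ι t)     ≡⟨ lem x y (ι s) (ι t) ⟩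
      x ℚ.* ι s ℚ.* ι t ℚ.+ y ℚ.* ι t ℚ.* ι s
        ≡⟨ cong₂ (λ u v → u ℚ.* ι t ℚ.+ v ℚ.* ι s) e f ⟩
      ι m ℚ.* ι t ℚ.+ ι n ℚ.* ι s     ≡⟨ cong₂ ℚ._+_ (ι-* m t) (ι-* n s) ⟨
      ι (m ℤ.* t) ℚ.+ ι (n ℤ.* s)     ≡⟨ ι-+ (m ℤ.* t) (n ℤ.* s) ⟨
      ι (m ℤ.* t ℤ.+ n ℤ.* s)         ∎
      where
      open ≡-Reasoning
      lem : ∀ x y s t → (x ℚ.+ y) ℚ.* (s ℚ.* t) ≡ x ℚ.* s ℚ.* t ℚ.+ y ℚ.* t ℚ.* s
      lem = solve-∀ ℚ-ring

    prod-eq : ∀ x y m s n t → x ℚ.* ι s ≡ ι m → y ℚ.* ι t ≡ ι n →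
      (x ℚ.* y) ℚ.* ι (s ℤ.* t) ≡ ι (m ℤ.* n)
    prod-eq x y m s n t e f = begin
      (x ℚ.* y) ℚ.* ι (s ℤ.* t)           ≡⟨ cong ((x ℚ.* y) ℚ.*_) (ι-* s t) ⟩
      (x ℚ.* y) ℚ.* (ι s ℚ.* ι t)         ≡⟨ *-interchange x y (ι s) (ι t) ⟩
      (x ℚ.* ι s) ℚ.* (y ℚ.* ι t)         ≡⟨ cong₂ ℚ._*_ e f ⟩
      ι m ℚ.* ι n                         ≡⟨ ι-* m n ⟨
      ι (m ℤ.* n)                         ∎
      where
      open ≡-Reasoning

  Integral-+ : ∀ {x y} → Integral x → Integral y → Integral (x ℚ.+ y)
  Integral-+ {x} {y} (integral m s p∤s e) (integral n t p∤t f) =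
    integral (m ℤ.* t ℤ.+ n ℤ.* s) (s ℤ.* t) (p∤* p∤s p∤t) (sum-eq x y m s n t e f)

  Integral-* : ∀ {x y} → Integral x → Integral y → Integral (x ℚ.* y)
  Integral-* {x} {y} (integral m s p∤s e) (integral n t p∤t f) =
    integral (m ℤ.* n) (s ℤ.* t) (p∤* p∤s p∤t) (prod-eq x y m s n t e f)

  Integral-pow : ∀ {x} → Integral x → ∀ n → Integral (pow x n)
  Integral-pow i zero    = Integral-ι 1ℤ
  Integral-pow i (suc n) = Integral-* i (Integral-pow i n)

  Unit-* : ∀ {x y} → Unit x → Unit y → Unit (x ℚ.* y)
  Unit-* {x} {y} (unit m s p∤m p∤s e) (unit n t p∤n p∤t f) =
    unit (m ℤ.* n) (s ℤ.* t) (p∤* p∤m p∤n) (p∤* p∤s p∤t) (prod-eq x y m s n t e f)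

  -- 1 + pℤ₍ₚ₎ consists of units: ℤ₍ₚ₎ is local
  Unit-+P* : ∀ {u y} → Unit u → Integral y → Unit (u ℚ.+ P ℚ.* y)
  Unit-+P* {u} {y} (unit m s p∤m p∤s e) (integral n t p∤t f) =
    -- The factor `1ℤ` is the denominator of `P`, which `prod-eq` multiplies in literally. In the
    -- numerator p divides the second summand but not the first.
    unit (m ℤ.* (1ℤ ℤ.* t) ℤ.+ (+ p ℤ.* n) ℤ.* s) (s ℤ.* (1ℤ ℤ.* t))
      (λ p∣ → p∤* p∤m (p∤* p∤1 p∤t) (ℤ.∣m+n∣n⇒∣m {m = m ℤ.* (1ℤ ℤ.* t)} p∣ (ℤ.∣m⇒∣m*n s (ℤ.∣m⇒∣m*n n ℤ.∣-refl))))
      (p∤* p∤s (p∤* p∤1 p∤t))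
      (sum-eq u (P ℚ.* y) m s (+ p ℤ.* n) (1ℤ ℤ.* t) e
        (prod-eq P y (+ p) 1ℤ n t (ℚ.*-identityʳ P) f))

  Unit⇒≢0 : ∀ {u} → Unit u → u ≢ 0ℚ
  Unit⇒≢0 (unit m s p∤m _ e) refl =
    p∤m (divides 0ℤ (ι-injective (trans (sym e) (ℚ.*-zeroˡ (ι s)))))

  Unit-inv : ∀ {u} → Unit u → Unit (inv u)
  Unit-inv {u} U@(unit m s p∤m p∤s e) = unit s m p∤s p∤m (begin
    inv u ℚ.* ι m           ≡⟨ cong (inv u ℚ.*_) e ⟨
    inv u ℚ.* (u ℚ.* ι s)   ≡⟨ lem (inv u) u (ι s) ⟩
    u ℚ.* inv u ℚ.* ι s     ≡⟨ cong (ℚ._* ι s) (inv-inverseʳ (Unit⇒≢0 U)) ⟩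
    1ℚ ℚ.* ι s              ≡⟨ ℚ.*-identityˡ (ι s) ⟩
    ι s                     ∎)
    where
    open ≡-Reasoning
    lem : ∀ v u s → v ℚ.* (u ℚ.* s) ≡ u ℚ.* v ℚ.* s
    lem = solve-∀ ℚ-ring

  -- Cross-multiplication would give `m t = s n p`, with neither `m` nor `t` divisible by the prime
  -- p.
  ¬Unit-P* : ∀ {x} → Integral x → ¬ Unit (P ℚ.* x)
  ¬Unit-P* {x} (integral n t p∤t f) (unit m s p∤m p∤s e) =
    p∤* p∤m p∤t (divides (s ℤ.* n) (ι-injective (begin
      ι (m ℤ.* t)                   ≡⟨ ι-* m t ⟩
      ι m ℚ.* ι t                   ≡⟨ cong (ℚ._* ι t) e ⟨
      P ℚ.* x ℚ.* ι s ℚ.* ι t       ≡⟨ lem P x (ι s) (ι t) ⟩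
      ι s ℚ.* (x ℚ.* ι t) ℚ.* P     ≡⟨ cong (λ z → ι s ℚ.* z ℚ.* P) f ⟩
      ι s ℚ.* ι n ℚ.* P             ≡⟨ cong (ℚ._* P) (ι-* s n) ⟨
      ι (s ℤ.* n) ℚ.* P             ≡⟨ ι-* (s ℤ.* n) (+ p) ⟨
      ι (s ℤ.* n ℤ.* + p)           ∎)))
    where
    open ≡-Reasoning
    lem : ∀ P x s t → P ℚ.* x ℚ.* s ℚ.* t ≡ s ℚ.* (x ℚ.* t) ℚ.* P
    lem = solve-∀ ℚ-ring

  -- Integer powers of p and valuations of rationals

  zp : ℤ → ℚ
  zp (+ n)    = pow P n
  zp -[1+ n ] = pow (inv P) (suc n)

  private
    zp-⊖ : ∀ m n → zp (m ℤ.⊖ n) ≡ pow P m ℚ.* pow (inv P) n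
    zp-⊖ m       zero    = sym (ℚ.*-identityʳ (pow P m))
    zp-⊖ zero    (suc n) = sym (ℚ.*-identityˡ (pow (inv P) (suc n)))
    zp-⊖ (suc m) (suc n) = begin
      zp (suc m ℤ.⊖ suc n)                             ≡⟨ cong zp (ℤ.[1+m]⊖[1+n]≡m⊖n m n) ⟩
      zp (m ℤ.⊖ n)                                     ≡⟨ zp-⊖ m n ⟩
      pow P m ℚ.* pow (inv P) n                        ≡⟨ ℚ.*-identityˡ _ ⟨
      1ℚ ℚ.* (pow P m ℚ.* pow (inv P) n)               ≡⟨ cong (ℚ._* (pow P m ℚ.* pow (inv P) n)) (inv-inverseʳ P≢0) ⟨
      P ℚ.* inv P ℚ.* (pow P m ℚ.* pow (inv P) n)      ≡⟨ *-interchange P (inv P) (pow P m) (pow (inv P) n) ⟩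
      P ℚ.* pow P m ℚ.* (inv P ℚ.* pow (inv P) n)      ∎
      where
      open ≡-Reasoning

  zp-+ : ∀ i j → zp (i ℤ.+ j) ≡ zp i ℚ.* zp j
  zp-+ (+ m)    (+ n)    = pow-+ P m n
  zp-+ (+ m)    -[1+ n ] = zp-⊖ m (suc n)
  zp-+ -[1+ m ] (+ n)    = trans (zp-⊖ n (suc m)) (ℚ.*-comm (pow P n) (pow (inv P) (suc m)))
  zp-+ -[1+ m ] -[1+ n ] = trans (cong (λ k → pow (inv P) (suc k)) (sym (ℕ.+-suc m n)))
    (pow-+ (inv P) (suc m) (suc n))

  zp-inverse : ∀ i → zp i ℚ.* zp (ℤ.- i) ≡ 1ℚ
  zp-inverse i = trans (sym (zp-+ i (ℤ.- i))) (cong zp (ℤ.+-inverseʳ i))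

  zp≢0 : ∀ i → zp i ≢ 0ℚ
  zp≢0 i e = ℚ.1≢0 (trans (sym (zp-inverse i)) (trans (cong (ℚ._* zp (ℤ.- i)) e) (ℚ.*-zeroˡ (zp (ℤ.- i)))))

  -- VG x N is ν_p(x) ≥ N, and Val x N is ν_p(x) = N (so x ≠ 0).
  record VG (x : ℚ) (N : ℤ) : Set where
    constructor vg
    field
      cofactor : ℚ
      cof-int  : Integral cofactor
      eq       : x ≡ zp N ℚ.* cofactor

  record Val (x : ℚ) (N : ℤ) : Set where
    constructor val
    field
      cofactor : ℚ
      cof-unit : Unit cofactor
      eq       : x ≡ zp N ℚ.* cofactor

  Val⇒VG : ∀ {x N} → Val x N → VG x N
  Val⇒VG (val u U e) = vg u (Unit⇒Integral U) e

  Val⇒≢0 : ∀ {x N} → Val x N → x ≢ 0ℚ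
  Val⇒≢0 {N = N} (val u U e) x≡0 = *≢0 (zp≢0 N) (Unit⇒≢0 U) (trans (sym e) x≡0)

  VG-0 : ∀ N → VG 0ℚ N
  VG-0 N = vg 0ℚ (Integral-ι 0ℤ) (sym (ℚ.*-zeroʳ (zp N)))

  VG-ι : ∀ m → VG (ι m) 0ℤ
  VG-ι m = vg (ι m) (Integral-ι m) (sym (ℚ.*-identityˡ (ι m)))

  Val-1 : Val 1ℚ 0ℤ
  Val-1 = val 1ℚ Unit-1 refl

  VG-+ : ∀ {x y N} → VG x N → VG y N → VG (x ℚ.+ y) N
  VG-+ {N = N} (vg u U e) (vg v V f) =
    vg (u ℚ.+ v) (Integral-+ U V) (trans (cong₂ ℚ._+_ e f) (sym (ℚ.*-distribˡ-+ (zp N) u v)))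

  private
    zp-*-cofactors : ∀ {x y u v} M N → x ≡ zp M ℚ.* u → y ≡ zp N ℚ.* v →
      x ℚ.* y ≡ zp (M ℤ.+ N) ℚ.* (u ℚ.* v)
    zp-*-cofactors {u = u} {v} M N refl refl =
      trans (*-interchange (zp M) u (zp N) v) (cong (ℚ._* (u ℚ.* v)) (sym (zp-+ M N)))

  VG-* : ∀ {x y M N} → VG x M → VG y N → VG (x ℚ.* y) (M ℤ.+ N)
  VG-* {M = M} {N} (vg u U e) (vg v V f) = vg (u ℚ.* v) (Integral-* U V) (zp-*-cofactors M N e f)

  Val-* : ∀ {x y M N} → Val x M → Val y N → Val (x ℚ.* y) (M ℤ.+ N)
  Val-* {M = M} {N} (val u U e) (val v V f) = val (u ℚ.* v) (Unit-* U V) (zp-*-cofactors M N e f)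

  VG-neg : ∀ {x N} → VG x N → VG (ℚ.- x) N
  VG-neg {x} {N} V = subst₂ VG (lem x) (ℤ.+-identityˡ N) (VG-* (VG-ι (ℤ.- 1ℤ)) V)
    where
    lem : ∀ x → ℚ.- 1ℚ ℚ.* x ≡ ℚ.- x
    lem = solve-∀ ℚ-ring

  VG-- : ∀ {x y N} → VG x N → VG y N → VG (x ℚ.- y) N
  VG-- U V = VG-+ U (VG-neg V)

  VG-mono : ∀ {x M N} → M ℤ.≤ N → VG x N → VG x M
  VG-mono {x} {M} {N} M≤N (vg u U e) =
    vg (pow P n ℚ.* u) (Integral-* (Integral-pow (Integral-ι (+ p)) n) U) (begin
      x                            ≡⟨ e ⟩
      zp N ℚ.* u                   ≡⟨ cong (λ i → zp i ℚ.* u) N≡ ⟩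
      zp (M ℤ.+ + n) ℚ.* u         ≡⟨ cong (ℚ._* u) (zp-+ M (+ n)) ⟩
      zp M ℚ.* pow P n ℚ.* u       ≡⟨ ℚ.*-assoc (zp M) (pow P n) u ⟩
      zp M ℚ.* (pow P n ℚ.* u)     ∎)
    where
    open ≡-Reasoning
    n = ℤ.∣ N ℤ.- M ∣
    lem : ∀ M N → N ≡ M ℤ.+ (N ℤ.- M)
    lem = ℤ.solve-∀
    N≡ : N ≡ M ℤ.+ + n
    N≡ = trans (lem M N) (cong (λ z → M ℤ.+ z) (sym (ℤ.0≤i⇒+∣i∣≡i (ℤ.i≤j⇒0≤j-i M≤N))))

  private
    zp-suc-* : ∀ N v → zp (N ℤ.+ 1ℤ) ℚ.* v ≡ zp N ℚ.* (P ℚ.* v)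
    zp-suc-* N v = trans (cong (ℚ._* v) (trans (zp-+ N 1ℤ) (cong (zp N ℚ.*_) (ℚ.*-identityʳ P))))
      (ℚ.*-assoc (zp N) P v)

  -- The equality case of the ultrametric inequality: once p^N is factored out, a unit plus a
  -- multiple of p remains.
  Val-+ : ∀ {x y N} → Val x N → VG y (N ℤ.+ 1ℤ) → Val (x ℚ.+ y) N
  Val-+ {N = N} (val u U e) (vg v V f) = val (u ℚ.+ P ℚ.* v) (Unit-+P* U V)
    (trans (cong₂ ℚ._+_ e (trans f (zp-suc-* N v))) (sym (ℚ.*-distribˡ-+ (zp N) u (P ℚ.* v))))

  ¬Val∧VG-suc : ∀ {x N} → Val x N → ¬ VG x (N ℤ.+ 1ℤ)
  ¬Val∧VG-suc {x} {N} (val u U e) (vg v V f) = ¬Unit-P* V (subst Unit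
    (*-cancelˡ-≢0 (zp≢0 N) (trans (sym e) (trans f (zp-suc-* N v)))) U)

  Val-inv : ∀ {x N} → Val x N → Val (inv x) (ℤ.- N)
  Val-inv {x} {N} (val u U e) = val (inv u) (Unit-inv U) (inv-unique {x} (begin
    x ℚ.* (zp (ℤ.- N) ℚ.* inv u)            ≡⟨ cong (ℚ._* (zp (ℤ.- N) ℚ.* inv u)) e ⟩
    zp N ℚ.* u ℚ.* (zp (ℤ.- N) ℚ.* inv u)   ≡⟨ *-interchange (zp N) u (zp (ℤ.- N)) (inv u) ⟩
    zp N ℚ.* zp (ℤ.- N) ℚ.* (u ℚ.* inv u)   ≡⟨ cong₂ ℚ._*_ (zp-inverse N) (inv-inverseʳ (Unit⇒≢0 U)) ⟩
    1ℚ ℚ.* 1ℚ                               ≡⟨⟩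
    1ℚ                                      ∎))
    where
    open ≡-Reasoning

  private
    -- `mult` computes only on `suc (suc q)`, so the induction `go` is over an arbitrary p > 1 that
    -- can be matched on. The fuel stays sufficient because `n / p < n`.
    mult-spec : ∀ f n → n ℕ.≤ f → n ≢ 0 → ∃ λ r → n ≡ p ℕ.^ mult f p n ℕ.* r × ¬ (p ℕ.∣ r)
    mult-spec = go p (ℕ.nonTrivial⇒n>1 p {{prime⇒nonTrivial pr}})
      where
      go : ∀ p → 1 ℕ.< p → ∀ f n → n ℕ.≤ f → n ≢ 0 →
        ∃ λ r → n ≡ p ℕ.^ mult f p n ℕ.* r × ¬ (p ℕ.∣ r)
      go p             1<p f       zero    _   n≢0 = ⊥-elim (n≢0 refl)
      go zero          ()  (suc f) (suc m) _   _
      go (suc zero)    (ℕ.s≤s ())  (suc f) (suc m) _   _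
      go p@(suc (suc q)) 1<p (suc f) n@(suc m) n≤f _ with p ℕ.∣? n
      ... | no p∤n = n , sym (ℕ.+-identityʳ n) , p∤n
      ... | yes p∣n = r , trans (sym (m*[n/m]≡n p∣n)) (trans (cong (p ℕ.*_) e) (sym (ℕ.*-assoc p (p ℕ.^ mult f p (n / p)) r))) , p∤r
        where
        n/p≢0 : n / p ≢ 0
        n/p≢0 z with trans (sym (m*[n/m]≡n p∣n)) (trans (cong (p ℕ.*_) z) (ℕ.*-zeroʳ p))
        ... | ()
        IH = go p 1<p f (n / p) (ℕ.≤-pred (ℕ.≤-trans (m/n<m n p 1<p) n≤f)) n/p≢0
        r = proj₁ IH
        e = proj₁ (proj₂ IH)
        p∤r = proj₂ (proj₂ IH)

  ι-^ : ∀ e → ι (+ (p ℕ.^ e)) ≡ pow P e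
  ι-^ zero    = refl
  ι-^ (suc e) = trans (cong ι (ℤ.pos-* p (p ℕ.^ e)))
    (trans (ι-* (+ p) (+ (p ℕ.^ e))) (cong (P ℚ.*_) (ι-^ e)))

  Val-ι-pos : ∀ n → n ≢ 0 → Val (ι (+ n)) (+ νℕ p n)
  Val-ι-pos n n≢0 with mult-spec n n ℕ.≤-refl n≢0
  ... | r , e , p∤r = val (ι (+ r))
    (unit (+ r) 1ℤ (p∤r ∘ ℤ.∣⇒∣ᵤ) p∤1 (ℚ.*-identityʳ (ι (+ r))))
    (trans (cong (ι ∘ +_) e) (trans (cong ι (ℤ.pos-* (p ℕ.^ νℕ p n) r))
      (trans (ι-* (+ (p ℕ.^ νℕ p n)) (+ r)) (cong (ℚ._* ι (+ r)) (ι-^ (νℕ p n))))))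

  Val-neg : ∀ {x N} → Val x N → Val (ℚ.- x) N
  Val-neg {x} {N} V = subst₂ Val (lem x) (ℤ.+-identityˡ N) (Val-* Val-[-1] V)
    where
    lem : ∀ x → ℚ.- 1ℚ ℚ.* x ≡ ℚ.- x
    lem = solve-∀ ℚ-ring
    Val-[-1] : Val (ℚ.- 1ℚ) 0ℤ
    Val-[-1] = val (ℚ.- 1ℚ) (unit (ℤ.- 1ℤ) 1ℤ (p∤1 ∘ ℤ.∣m⇒∣-m) p∤1 refl) refl

  Val-ι : ∀ m → m ≢ 0ℤ → Val (ι m) (+ νℕ p ℤ.∣ m ∣)
  Val-ι (+ n)    m≢0 = Val-ι-pos n (m≢0 ∘ cong +_)
  Val-ι -[1+ n ] m≢0 = Val-neg (Val-ι-pos (suc n) (λ ()))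

  -- The bridge from the computed `νℚ` to `Val`. It holds because numerator and inverted denominator
  -- contribute separately, so coprimality plays no part in the argument.
  Val-ν : ∀ {q} → q ≢ 0ℚ → Val q (νℚ p q)
  Val-ν {q} q≢0 = subst (λ z → Val z (νℚ p q)) eq
    (Val-* (Val-ι (↥ q) (q≢0 ∘ ℚ.↥p≡0⇒p≡0 q)) (Val-inv (Val-ι (↧ q) (λ ()))))
    where
    open ≡-Reasoning
    eq : ι (↥ q) ℚ.* inv (ι (↧ q)) ≡ q
    eq = begin
      ι (↥ q) ℚ.* inv (ι (↧ q))             ≡⟨ cong (ℚ._* inv (ι (↧ q))) (*-↧ q) ⟨
      q ℚ.* ι (↧ q) ℚ.* inv (ι (↧ q))       ≡⟨ ℚ.*-assoc q _ _ ⟩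
      q ℚ.* (ι (↧ q) ℚ.* inv (ι (↧ q)))     ≡⟨ cong (q ℚ.*_) (inv-inverseʳ (λ e → absurd (ι-injective {↧ q} {0ℤ} e))) ⟩
      q ℚ.* 1ℚ                              ≡⟨ ℚ.*-identityʳ q ⟩
      q                                     ∎
      where
      absurd : ↧ q ≢ 0ℤ
      absurd ()

  ValGe⇒VG : ∀ {q N} → ValGe p q N → VG q N
  ValGe⇒VG {N = N} (inj₁ refl) = VG-0 N
  -- At 0 the number `νℚ p q` is a default value, but zero satisfies every bound `VG`.
  ValGe⇒VG {q} {N} (inj₂ N≤ν) with q ℚ.≟ 0ℚ
  ... | yes refl = VG-0 N
  ... | no q≢0   = VG-mono N≤ν (Val⇒VG (Val-ν q≢0))

  -- Products of n factors of valuation at least −L, the factors being E-close.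
  record Close (L E : ℤ) (n : ℕ) (x y : ℚ) : Set where
    constructor close
    field
      ≥ˡ   : VG x (ℤ.- (+ n ℤ.* L))
      ≥ʳ   : VG y (ℤ.- (+ n ℤ.* L))
      -- This is E - (n - 1) L, one error and n - 1 remaining factors, written so that it also makes
      -- sense for n = 0.
      diff : VG (x ℚ.- y) (E ℤ.+ L ℤ.- + n ℤ.* L)

  Close-1 : ∀ {L E} → Close L E 0 1ℚ 1ℚ
  Close-1 {L} {E} = close V V (VG-0 (E ℤ.+ L ℤ.- 0ℤ ℤ.* L))
    where
    V : VG 1ℚ (ℤ.- (0ℤ ℤ.* L))
    V = subst (VG 1ℚ) (lem L) (Val⇒VG Val-1)
      where
      lem : ∀ L → 0ℤ ≡ ℤ.- (0ℤ ℤ.* L)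
      lem = ℤ.solve-∀

  Close-single : ∀ {L E x y} → VG x (ℤ.- L) → VG y (ℤ.- L) → VG (x ℚ.- y) E → Close L E 1 x y
  Close-single {L} {E} {x} {y} u v w =
    close (subst (VG x) (lem₁ L) u) (subst (VG y) (lem₁ L) v) (subst (VG (x ℚ.- y)) (lem₂ E L) w)
    where
    lem₁ : ∀ L → ℤ.- L ≡ ℤ.- (1ℤ ℤ.* L)
    lem₁ = ℤ.solve-∀
    lem₂ : ∀ E L → E ≡ E ℤ.+ L ℤ.- 1ℤ ℤ.* L
    lem₂ = ℤ.solve-∀

  -- Telescoping: x x′ - y y′ = (x - y) x′ + y (x′ - y′). Both summands meet the same bound, since
  -- the exponents are additive in the number of factors apart from a single `E + L`.
  Close-* : ∀ {L E m n x y x′ y′} → Close L E m x y → Close L E n x′ y′ →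
    Close L E (m ℕ.+ n) (x ℚ.* x′) (y ℚ.* y′)
  Close-* {L} {E} {m} {n} {x} {y} {x′} {y′} (close u v w) (close u′ v′ w′) = close
    (subst (VG (x ℚ.* x′)) (lem₁ (+ m) (+ n) L) (VG-* u u′))
    (subst (VG (y ℚ.* y′)) (lem₁ (+ m) (+ n) L) (VG-* v v′))
    (subst (λ z → VG z (E ℤ.+ L ℤ.- + (m ℕ.+ n) ℤ.* L)) (lem₄ x y x′ y′)
      (VG-+ (subst (VG ((x ℚ.- y) ℚ.* x′)) (lem₂ (+ m) (+ n) L E) (VG-* w u′))
            (subst (VG (y ℚ.* (x′ ℚ.- y′))) (lem₃ (+ m) (+ n) L E) (VG-* v w′))))
    where
    lem₁ : ∀ m n L → ℤ.- (m ℤ.* L) ℤ.+ (ℤ.- (n ℤ.* L)) ≡ ℤ.- ((m ℤ.+ n) ℤ.* L)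
    lem₁ = ℤ.solve-∀
    lem₂ : ∀ m n L E → E ℤ.+ L ℤ.- m ℤ.* L ℤ.+ (ℤ.- (n ℤ.* L)) ≡ E ℤ.+ L ℤ.- (m ℤ.+ n) ℤ.* L
    lem₂ = ℤ.solve-∀
    lem₃ : ∀ m n L E → ℤ.- (m ℤ.* L) ℤ.+ (E ℤ.+ L ℤ.- n ℤ.* L) ≡ E ℤ.+ L ℤ.- (m ℤ.+ n) ℤ.* L
    lem₃ = ℤ.solve-∀
    lem₄ : ∀ x y x′ y′ → (x ℚ.- y) ℚ.* x′ ℚ.+ y ℚ.* (x′ ℚ.- y′) ≡ x ℚ.* x′ ℚ.- y ℚ.* y′
    lem₄ = solve-∀ ℚ-ring

  Close-pow : ∀ {L E x y} → Close L E 1 x y → ∀ n → Close L E n (pow x n) (pow y n)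
  Close-pow C zero    = Close-1
  Close-pow C (suc n) = Close-* C (Close-pow C n)

  VG-sumTo-diff : ∀ n {f g : ℕ → ℚ} {N} → (∀ i → VG (f i ℚ.- g i) N) → VG (sumTo n f ℚ.- sumTo n g) N
  VG-sumTo-diff zero    h = h 0
  VG-sumTo-diff (suc n) {f} {g} {N} h = subst (λ z → VG z N)
    (lem (sumTo n f) (sumTo n g) (f (suc n)) (g (suc n))) (VG-+ (VG-sumTo-diff n h) (h (suc n)))
    where
    lem : ∀ a b c d → a ℚ.- b ℚ.+ (c ℚ.- d) ≡ a ℚ.+ c ℚ.- (b ℚ.+ d)
    lem = solve-∀ ℚ-ring

  module _ (F : Poly) (D : ℕ) (degree : ∀ i j → ¬ (coeff F i j ≡ 0ℚ) → i ℕ.+ j ≤ D) (M : ℤ)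
    (c-integer : ∀ i j → IsInteger (ι M ℚ.* coeff F i j)) where
    open Homogenisation F D degree M

    -- Multiplication by `M` has made the coefficients integers, so they cost no valuation; what
    -- remains are monomials of exactly D factors.
    VG-H-diff : ∀ {L E x y z x′ y′ z′} → Close L E 1 x x′ → Close L E 1 y y′ → Close L E 1 z z′ →
      VG (H x y z ℚ.- H x′ y′ z′) (E ℤ.+ L ℤ.- + D ℤ.* L)
    VG-H-diff {L} {E} {x} {y} {z} {x′} {y′} {z′} X Y Z =
      VG-sumTo-diff (bound F) λ i → VG-sumTo-diff (bound F) λ j → term i j (term-cases i j)
      where
      W = E ℤ.+ L ℤ.- + D ℤ.* L
      lem₁ : ∀ s t → 0ℚ ≡ 0ℚ ℚ.* s ℚ.- 0ℚ ℚ.* t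
      lem₁ = solve-∀ ℚ-ring
      lem₂ : ∀ c s t → c ℚ.* (s ℚ.- t) ≡ c ℚ.* s ℚ.- c ℚ.* t
      lem₂ = solve-∀ ℚ-ring
      term : ∀ i j → c i j ≡ 0ℚ ⊎ i ℕ.+ j ℕ.+ (D ℕ.∸ (i ℕ.+ j)) ≡ D →
        VG (c i j ℚ.* monomial x y z i j ℚ.- c i j ℚ.* monomial x′ y′ z′ i j) W
      term i j (inj₁ e) = subst (λ k → VG (k ℚ.* monomial x y z i j ℚ.- k ℚ.* monomial x′ y′ z′ i j) W) (sym e)
        (subst (λ q → VG q W) (lem₁ (monomial x y z i j) (monomial x′ y′ z′ i j)) (VG-0 W))
      term i j (inj₂ e) = subst (λ q → VG q W) (lem₂ (c i j) (monomial x y z i j) (monomial x′ y′ z′ i j))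
        (subst (VG _) (ℤ.+-identityˡ W) (VG-* c≥0 (Close.diff mono)))
        where
        c≥0 : VG (c i j) 0ℤ
        c≥0 = subst (λ q → VG q 0ℤ) (sym (proj₂ (c-integer i j))) (VG-ι (proj₁ (c-integer i j)))
        mono : Close L E D (monomial x y z i j) (monomial x′ y′ z′ i j)
        mono = subst (λ n → Close L E n (monomial x y z i j) (monomial x′ y′ z′ i j)) e
          (Close-* (Close-* (Close-pow X i) (Close-pow Y j)) (Close-pow Z (D ℕ.∸ (i ℕ.+ j))))

  -- membership in ℤ[1/p]
  record PInt (x : ℚ) : Set where
    constructor pint
    field
      expo : ℕ
      num  : ℤ
      eq   : x ℚ.* pow P expo ≡ ι num

  PInt-ι : ∀ m → PInt (ι m)
  PInt-ι m = pint 0 m (ℚ.*-identityʳ (ι m))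

  PInt-* : ∀ {x y} → PInt x → PInt y → PInt (x ℚ.* y)
  PInt-* {x} {y} (pint e m u) (pint f n v) = pint (e ℕ.+ f) (m ℤ.* n) (begin
    x ℚ.* y ℚ.* pow P (e ℕ.+ f)            ≡⟨ cong (x ℚ.* y ℚ.*_) (pow-+ P e f) ⟩
    x ℚ.* y ℚ.* (pow P e ℚ.* pow P f)      ≡⟨ *-interchange x y (pow P e) (pow P f) ⟩
    x ℚ.* pow P e ℚ.* (y ℚ.* pow P f)      ≡⟨ cong₂ ℚ._*_ u v ⟩
    ι m ℚ.* ι n                            ≡⟨ ι-* m n ⟨
    ι (m ℤ.* n)                            ∎)
    where
    open ≡-Reasoning

  PInt-+ : ∀ {x y} → PInt x → PInt y → PInt (x ℚ.+ y)
  PInt-+ {x} {y} (pint e m u) (pint f n v) =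
    pint (e ℕ.+ f) (m ℤ.* + (p ℕ.^ f) ℤ.+ n ℤ.* + (p ℕ.^ e)) (begin
    (x ℚ.+ y) ℚ.* pow P (e ℕ.+ f)            ≡⟨ cong ((x ℚ.+ y) ℚ.*_) (pow-+ P e f) ⟩
    (x ℚ.+ y) ℚ.* (pow P e ℚ.* pow P f)      ≡⟨ lem x y (pow P e) (pow P f) ⟩
    x ℚ.* pow P e ℚ.* pow P f ℚ.+ y ℚ.* pow P f ℚ.* pow P e
      ≡⟨ cong₂ ℚ._+_ (cong₂ ℚ._*_ u (sym (ι-^ f))) (cong₂ ℚ._*_ v (sym (ι-^ e))) ⟩
    ι m ℚ.* ι (+ (p ℕ.^ f)) ℚ.+ ι n ℚ.* ι (+ (p ℕ.^ e))
      ≡⟨ cong₂ ℚ._+_ (ι-* m (+ (p ℕ.^ f))) (ι-* n (+ (p ℕ.^ e))) ⟨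
    ι (m ℤ.* + (p ℕ.^ f)) ℚ.+ ι (n ℤ.* + (p ℕ.^ e))
      ≡⟨ ι-+ (m ℤ.* + (p ℕ.^ f)) (n ℤ.* + (p ℕ.^ e)) ⟨
    ι (m ℤ.* + (p ℕ.^ f) ℤ.+ n ℤ.* + (p ℕ.^ e)) ∎)
    where
    open ≡-Reasoning
    lem : ∀ x y a b → (x ℚ.+ y) ℚ.* (a ℚ.* b) ≡ x ℚ.* a ℚ.* b ℚ.+ y ℚ.* b ℚ.* a
    lem = solve-∀ ℚ-ring

  PInt-pow : ∀ {x} → PInt x → ∀ n → PInt (pow x n)
  PInt-pow X zero    = PInt-ι 1ℤ
  PInt-pow X (suc n) = PInt-* X (PInt-pow X n)

  PInt-inv-P : PInt (inv P)
  PInt-inv-P = pint 1 1ℤ (trans (cong (inv P ℚ.*_) (ℚ.*-identityʳ P))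
    (trans (ℚ.*-comm (inv P) P) (inv-inverseʳ P≢0)))

  PInt-zp : ∀ i → PInt (zp i)
  PInt-zp (+ n)    = PInt-pow (PInt-ι (+ p)) n
  PInt-zp -[1+ n ] = PInt-pow PInt-inv-P (suc n)

  PInt-sumTo : ∀ n {f : ℕ → ℚ} → (∀ i → PInt (f i)) → PInt (sumTo n f)
  PInt-sumTo zero    h = h 0
  PInt-sumTo (suc n) h = PInt-+ (PInt-sumTo n h) (h (suc n))

  PInt-sumFin : ∀ n {f : Fin n → ℚ} → (∀ i → PInt (f i)) → PInt (sumFin n f)
  PInt-sumFin zero    h = PInt-ι 0ℤ
  PInt-sumFin (suc n) h = PInt-+ (h Fin.zero) (PInt-sumFin n (h ∘ Fin.suc))

  -- Descent on the exponent of p in the denominator: either p divides the numerator and cancels, or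
  -- the fraction is not p-integral.
  PInt∧Integral⇒IsInteger : ∀ {x} → PInt x → Integral x → IsInteger x
  PInt∧Integral⇒IsInteger {x} (pint e m eq) (integral n t p∤t f) = go e m eq
    where
    open ≡-Reasoning
    lem₁ : ∀ x P w t → x ℚ.* (P ℚ.* w) ℚ.* t ≡ w ℚ.* (x ℚ.* t) ℚ.* P
    lem₁ = solve-∀ ℚ-ring
    lem₂ : ∀ x P w → P ℚ.* (x ℚ.* w) ≡ x ℚ.* (P ℚ.* w)
    lem₂ = solve-∀ ℚ-ring
    go : ∀ e m → x ℚ.* pow P e ≡ ι m → IsInteger x
    go zero    m eq = m , trans (sym (ℚ.*-identityʳ x)) eq
    go (suc e) m eq with + p ℤ.∣? m
    ... | yes (divides q refl) = go e q (*-cancelˡ-≢0 P≢0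
      (trans (lem₂ x P (pow P e)) (trans eq (trans (ι-* q (+ p)) (ℚ.*-comm (ι q) P)))))
    ... | no p∤m = ⊥-elim (p∤* p∤m p∤t (divides (+ (p ℕ.^ e) ℤ.* n) (ι-injective (begin
      ι (m ℤ.* t)                            ≡⟨ ι-* m t ⟩
      ι m ℚ.* ι t                            ≡⟨ cong (ℚ._* ι t) eq ⟨
      x ℚ.* (P ℚ.* pow P e) ℚ.* ι t          ≡⟨ lem₁ x P (pow P e) (ι t) ⟩
      pow P e ℚ.* (x ℚ.* ι t) ℚ.* P          ≡⟨ cong₂ (λ u v → u ℚ.* v ℚ.* P) (sym (ι-^ e)) f ⟩
      ι (+ (p ℕ.^ e)) ℚ.* ι n ℚ.* P          ≡⟨ cong (ℚ._* P) (ι-* (+ (p ℕ.^ e)) n) ⟨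
      ι (+ (p ℕ.^ e) ℤ.* n) ℚ.* P            ≡⟨ ι-* (+ (p ℕ.^ e) ℤ.* n) (+ p) ⟨
      ι (+ (p ℕ.^ e) ℤ.* n ℤ.* + p)          ∎))))

  0≤P : 0ℚ ℚ.≤ P
  0≤P = ι-mono-≤ (ℤ.+≤+ (ℕ.z≤n {p}))

  0≤inv-P : 0ℚ ℚ.≤ inv P
  0≤inv-P = [ (λ 0≤i → 0≤i) , (λ i≤0 → ⊥-elim (1≰0 (subst₂ ℚ._≤_ (inv-inverseʳ P≢0) (ℚ.*-zeroʳ P)
    (ℚ.*-monoˡ-≤-nonNeg P {{ℚ.nonNegative 0≤P}} i≤0)))) ]′ (ℚ.≤-total 0ℚ (inv P))

  0≤zp : ∀ i → 0ℚ ℚ.≤ zp i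
  0≤zp (+ n)    = 0≤pow 0≤P n
  0≤zp -[1+ n ] = 0≤pow 0≤inv-P (suc n)

  -- x p^(−N) is a non-zero element of ℤ[1/p] ∩ ℤ₍ₚ₎ = ℤ.
  zp≤∣∣ : ∀ {x N} → PInt x → VG x N → x ≢ 0ℚ → zp N ℚ.≤ ℚ.∣ x ∣
  zp≤∣∣ {x} {N} X (vg y Y e) x≢0 = subst₂ ℚ._≤_ (ℚ.*-identityʳ (zp N)) ∣x∣-eq
    (ℚ.*-monoˡ-≤-nonNeg (zp N) {{ℚ.nonNegative (0≤zp N)}} 1≤∣y∣)
    where
    open ≡-Reasoning
    y-eq : zp (ℤ.- N) ℚ.* x ≡ y
    y-eq = begin
      zp (ℤ.- N) ℚ.* x                  ≡⟨ cong (zp (ℤ.- N) ℚ.*_) e ⟩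
      zp (ℤ.- N) ℚ.* (zp N ℚ.* y)       ≡⟨ lem (zp (ℤ.- N)) (zp N) y ⟩
      zp N ℚ.* zp (ℤ.- N) ℚ.* y         ≡⟨ cong (ℚ._* y) (zp-inverse N) ⟩
      1ℚ ℚ.* y                          ≡⟨ ℚ.*-identityˡ y ⟩
      y                                 ∎
      where
      lem : ∀ a b y → a ℚ.* (b ℚ.* y) ≡ b ℚ.* a ℚ.* y
      lem = solve-∀ ℚ-ring
    y-integer : IsInteger y
    y-integer = PInt∧Integral⇒IsInteger (subst PInt y-eq (PInt-* (PInt-zp (ℤ.- N)) X)) Y
    y≢0 : y ≢ 0ℚ
    y≢0 y≡0 = x≢0 (trans e (trans (cong (zp N ℚ.*_) y≡0) (ℚ.*-zeroʳ (zp N))))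
    1≤∣ι∣ : ∀ m → ι m ≢ 0ℚ → 1ℚ ℚ.≤ ℚ.∣ ι m ∣
    1≤∣ι∣ (+ zero)    ne = ⊥-elim (ne refl)
    1≤∣ι∣ m@(+ suc n) ne = subst (1ℚ ℚ.≤_) (sym (ι-∣∣ m)) (ι-mono-≤ (ℤ.+≤+ (ℕ.s≤s (ℕ.z≤n {n}))))
    1≤∣ι∣ m@(-[1+ n ]) ne = subst (1ℚ ℚ.≤_) (sym (ι-∣∣ m)) (ι-mono-≤ (ℤ.+≤+ (ℕ.s≤s (ℕ.z≤n {n}))))
    1≤∣y∣ : 1ℚ ℚ.≤ ℚ.∣ y ∣
    1≤∣y∣ = subst (λ z → 1ℚ ℚ.≤ ℚ.∣ z ∣) (sym (proj₂ y-integer))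
      (1≤∣ι∣ (proj₁ y-integer) (λ z → y≢0 (trans (proj₂ y-integer) z)))
    ∣x∣-eq : zp N ℚ.* ℚ.∣ y ∣ ≡ ℚ.∣ x ∣
    ∣x∣-eq = trans (cong (ℚ._* ℚ.∣ y ∣) (sym (ℚ.0≤p⇒∣p∣≡p (0≤zp N))))
      (trans (sym (ℚ.∣p*q∣≡∣p∣*∣q∣ (zp N) y)) (cong ℚ.∣_∣ (sym e)))

  PInt-digitSum : ∀ m d → PInt (digitSum p m d)
  PInt-digitSum m d = PInt-sumFin (suc m) λ i → PInt-* (PInt-ι (d i)) (PInt-pow PInt-inv-P (toℕ i))

  private
    -- Strictness of the balance condition gains the extra 1. Halved, it pays for the tail
    -- `inv P * (½ * P)` in `∣digits∣≤P/2`.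
    balanced-bound : ∀ x → Balanced p x → 2 ℕ.* ℤ.∣ x ∣ ℕ.+ 1 ≤ p
    balanced-bound x (-p<2x , 2x<p) =
      subst (_≤ p) (ℕ.+-comm 1 _) (subst (ℕ._< p) (ℤ.abs-* (+ 2) x) (abs< p (+ 2 ℤ.* x) -p<2x 2x<p))
      where
      abs< : ∀ p i → ℤ.- (+ p) ℤ.< i → i ℤ.< + p → ℤ.∣ i ∣ ℕ.< p
      abs< p       (+ n)    _           (ℤ.+<+ n<p) = n<p
      abs< zero    -[1+ n ] () _
      abs< (suc p) -[1+ n ] (ℤ.-<- n<p) _           = ℕ.s≤s n<p

    sumFin-cong : ∀ n {f g : Fin n → ℚ} → (∀ i → f i ≡ g i) → sumFin n f ≡ sumFin n g
    sumFin-cong zero    h = refl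
    sumFin-cong (suc n) h = cong₂ ℚ._+_ (h Fin.zero) (sumFin-cong n (h ∘ Fin.suc))

    *-sumFin : ∀ q n f → q ℚ.* sumFin n f ≡ sumFin n (λ i → q ℚ.* f i)
    *-sumFin q zero    f = ℚ.*-zeroʳ q
    *-sumFin q (suc n) f = trans (ℚ.*-distribˡ-+ q (f Fin.zero) (sumFin n (f ∘ Fin.suc)))
      (cong (q ℚ.* f Fin.zero ℚ.+_) (*-sumFin q n (f ∘ Fin.suc)))

  -- Horner: a = d₀ + a′/p with ∣d₀∣ ≤ (p − 1)/2 and ∣a′∣ ≤ p/2.
  ∣digits∣≤P/2 : ∀ n (d : Fin n → ℤ) → (∀ i → Balanced p (d i)) →
    ℚ.∣ sumFin n (λ i → (d i ℚ./ 1) ℚ.* pow (inv P) (toℕ i)) ∣ ℚ.≤ ½ ℚ.* P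
  ∣digits∣≤P/2 zero    d bal = 0≤* (ℚ.nonNegative⁻¹ ½) 0≤P
  ∣digits∣≤P/2 (suc n) d bal = ℚ.≤-trans
    (subst (ℚ._≤ ℚ.∣ ι d₀ ∣ ℚ.+ inv P ℚ.* (½ ℚ.* P)) (cong ℚ.∣_∣ (sym horner))
      (∣+∣≤ {ι d₀} {inv P ℚ.* S} ℚ.≤-refl
        (∣*∣≤ {inv P} {S} (ℚ.≤-reflexive (ℚ.0≤p⇒∣p∣≡p 0≤inv-P)) (∣digits∣≤P/2 n (d ∘ Fin.suc) (bal ∘ Fin.suc)))))
    (subst (ℚ._≤ ½ ℚ.* P) (sym half)
      (ℚ.*-monoˡ-≤-nonNeg ½ (ι-mono-≤ (ℤ.+≤+ (balanced-bound d₀ (bal Fin.zero))))))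
    where
    open ≡-Reasoning
    d₀ = d Fin.zero
    S = sumFin n (λ i → (d (Fin.suc i) ℚ./ 1) ℚ.* pow (inv P) (toℕ i))
    lem : ∀ d i w → d ℚ.* (i ℚ.* w) ≡ i ℚ.* (d ℚ.* w)
    lem = solve-∀ ℚ-ring
    horner : sumFin (suc n) (λ i → (d i ℚ./ 1) ℚ.* pow (inv P) (toℕ i)) ≡ ι d₀ ℚ.+ inv P ℚ.* S
    horner = cong₂ ℚ._+_ (ℚ.*-identityʳ (ι d₀))
      (trans (sumFin-cong n (λ i → lem (ι (d (Fin.suc i))) (inv P) (pow (inv P) (toℕ i))))
        (sym (*-sumFin (inv P) n _)))
    half : ℚ.∣ ι d₀ ∣ ℚ.+ inv P ℚ.* (½ ℚ.* P) ≡ ½ ℚ.* ι (+ (2 ℕ.* ℤ.∣ d₀ ∣ ℕ.+ 1))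
    half = begin
      ℚ.∣ ι d₀ ∣ ℚ.+ inv P ℚ.* (½ ℚ.* P)        ≡⟨ cong (ℚ._+ inv P ℚ.* (½ ℚ.* P)) (ι-∣∣ d₀) ⟩
      ι (+ k) ℚ.+ inv P ℚ.* (½ ℚ.* P)           ≡⟨ lem₁ (ι (+ k)) (inv P) P ⟩
      ι (+ k) ℚ.+ ½ ℚ.* (P ℚ.* inv P)           ≡⟨ cong (λ z → ι (+ k) ℚ.+ ½ ℚ.* z) (inv-inverseʳ P≢0) ⟩
      ι (+ k) ℚ.+ ½ ℚ.* 1ℚ                      ≡⟨ lem₂ (ι (+ k)) ⟩
      ½ ℚ.* (ι (+ 2) ℚ.* ι (+ k) ℚ.+ 1ℚ)        ≡⟨ cong (λ z → ½ ℚ.* (z ℚ.+ 1ℚ)) (ι-* (+ 2) (+ k)) ⟨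
      ½ ℚ.* (ι (+ 2 ℤ.* + k) ℚ.+ 1ℚ)            ≡⟨ cong (½ ℚ.*_) (ι-+ (+ 2 ℤ.* + k) 1ℤ) ⟨
      ½ ℚ.* ι (+ 2 ℤ.* + k ℤ.+ 1ℤ)              ≡⟨ cong (λ z → ½ ℚ.* ι (z ℤ.+ 1ℤ)) (ℤ.pos-* 2 k) ⟨
      ½ ℚ.* ι (+ (2 ℕ.* k ℕ.+ 1))               ∎
      where
      k = ℤ.∣ d₀ ∣
      lem₁ : ∀ k i P → k ℚ.+ i ℚ.* (½ ℚ.* P) ≡ k ℚ.+ ½ ℚ.* (P ℚ.* i)
      lem₁ = solve-∀ ℚ-ring
      lem₂ : ∀ k → k ℚ.+ ½ ℚ.* 1ℚ ≡ ½ ℚ.* ((1ℚ ℚ.+ 1ℚ) ℚ.* k ℚ.+ 1ℚ)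
      lem₂ = solve-∀ ℚ-ring

  PInt-trip : ∀ {x₂ x₁ x₀} {a b : ℕ → ℚ} → PInt x₂ → PInt x₁ → PInt x₀ →
    (∀ n → PInt (a n)) → (∀ n → PInt (b n)) → ∀ n →
    let t = trip x₂ x₁ x₀ a b n in PInt (first t) × PInt (second t) × PInt (third t)
  PInt-trip X₂ X₁ X₀ A B zero    = X₂ , X₁ , X₀
  PInt-trip X₂ X₁ X₀ A B (suc n) with PInt-trip X₂ X₁ X₀ A B n
  ... | u , v , w = v , w , PInt-+ (PInt-+ (PInt-* (A (suc n)) w) (PInt-* (B (suc n)) v)) u

  -- Convergents grow at most like λ^n: any λ < p with λ³ ≥ (p/2)(λ² + λ) + 1 would do.
  module Size (p≢2 : ¬ (p ≡ 2)) where

    ℓ : ℚ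
    ℓ = P ℚ.- ½

    private
      μ : ℚ
      μ = P ℚ.- ι (+ 3)

      0≤μ : 0ℚ ℚ.≤ μ
      0≤μ = subst (ℚ._≤ μ) (ℚ.+-inverseʳ (ι (+ 3))) (ℚ.+-monoˡ-≤ (ℚ.- ι (+ 3))
        (ι-mono-≤ {+ 3} {+ p} (ℤ.+≤+ (ℕ.≤∧≢⇒< (ℕ.nonTrivial⇒n>1 p {{prime⇒nonTrivial pr}}) (p≢2 ∘ sym)))))

      -- The polynomial ℓ³ - (p/2)(ℓ² + ℓ) - 1, expanded in powers of μ = p - 3. All coefficients
      -- come out positive, so it is non-negative for every p ≥ 3.
      R : ℚ
      R = (+ 3 ℚ./ 2) ℚ.+ μ ℚ.* ((+ 43 ℚ./ 8) ℚ.+ μ ℚ.* ((+ 3 ℚ./ 1) ℚ.+ μ ℚ.* ½))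

      0≤R : 0ℚ ℚ.≤ R
      0≤R = 0≤+ {+ 3 ℚ./ 2} (ℚ.nonNegative⁻¹ (+ 3 ℚ./ 2)) (0≤* 0≤μ
        (0≤+ {+ 43 ℚ./ 8} (ℚ.nonNegative⁻¹ (+ 43 ℚ./ 8)) (0≤* 0≤μ
          (0≤+ {+ 3 ℚ./ 1} (ℚ.nonNegative⁻¹ (+ 3 ℚ./ 1)) (0≤* 0≤μ (ℚ.nonNegative⁻¹ ½))))))

      characteristic : ∀ y → ½ ℚ.* P ℚ.* (ℓ ℚ.* (ℓ ℚ.* y)) ℚ.+ ½ ℚ.* P ℚ.* (ℓ ℚ.* y) ℚ.+ y ℚ.+ R ℚ.* y ≡
        ℓ ℚ.* (ℓ ℚ.* (ℓ ℚ.* y))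
      characteristic = lem P
        where
        lem : ∀ P y → ½ ℚ.* P ℚ.* ((P ℚ.- ½) ℚ.* ((P ℚ.- ½) ℚ.* y)) ℚ.+ ½ ℚ.* P ℚ.* ((P ℚ.- ½) ℚ.* y) ℚ.+ y ℚ.+
            ((+ 3 ℚ./ 2) ℚ.+ (P ℚ.- (+ 3 ℚ./ 1)) ℚ.* ((+ 43 ℚ./ 8) ℚ.+ (P ℚ.- (+ 3 ℚ./ 1)) ℚ.*
              ((+ 3 ℚ./ 1) ℚ.+ (P ℚ.- (+ 3 ℚ./ 1)) ℚ.* ½))) ℚ.* y ≡
            (P ℚ.- ½) ℚ.* ((P ℚ.- ½) ℚ.* ((P ℚ.- ½) ℚ.* y))
        lem = solve-∀ ℚ-ring

    1≤ℓ : 1ℚ ℚ.≤ ℓ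
    1≤ℓ = subst₂ ℚ._≤_ (ℚ.+-identityʳ 1ℚ) (lem P)
      (ℚ.+-monoʳ-≤ 1ℚ {0ℚ} (0≤+ {+ 3 ℚ./ 2} (ℚ.nonNegative⁻¹ (+ 3 ℚ./ 2)) 0≤μ))
      where
      lem : ∀ P → 1ℚ ℚ.+ ((+ 3 ℚ./ 2) ℚ.+ (P ℚ.- (+ 3 ℚ./ 1))) ≡ P ℚ.- ½
      lem = solve-∀ ℚ-ring

    0≤ℓ : 0ℚ ℚ.≤ ℓ
    0≤ℓ = ℚ.≤-trans 0≤1 1≤ℓ

    1≤pow-ℓ : ∀ n → 1ℚ ℚ.≤ pow ℓ n
    1≤pow-ℓ zero    = ℚ.≤-refl
    1≤pow-ℓ (suc n) = *-mono-≤-0≤ 0≤1 1≤ℓ 0≤1 (1≤pow-ℓ n)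

    module _ {a b : ℕ → ℚ} (∣a∣≤ : ∀ n → ℚ.∣ a n ∣ ℚ.≤ ½ ℚ.* P) (∣b∣≤ : ∀ n → ℚ.∣ b n ∣ ℚ.≤ ½ ℚ.* P)
      {x₂ x₁ x₀ k : ℚ} (x₂≤ : ℚ.∣ x₂ ∣ ℚ.≤ k) (x₁≤ : ℚ.∣ x₁ ∣ ℚ.≤ k) (x₀≤ : ℚ.∣ x₀ ∣ ℚ.≤ k) where

      private
        0≤k : 0ℚ ℚ.≤ k
        0≤k = ℚ.≤-trans (ℚ.0≤∣p∣ x₂) x₂≤

        ≤*pow : ∀ {x} n → x ℚ.≤ k → x ℚ.≤ pow ℓ n ℚ.* k
        ≤*pow n x≤k = ℚ.≤-trans x≤k (subst (ℚ._≤ pow ℓ n ℚ.* k) (ℚ.*-identityˡ k)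
          (ℚ.*-monoʳ-≤-nonNeg k {{ℚ.nonNegative 0≤k}} (1≤pow-ℓ n)))

      -- Three consecutive entries get three consecutive powers of `ℓ`. The recurrence then
      -- reproduces the left side of `characteristic`, and the slack `R` is discarded.
      ∣trip∣≤ : ∀ n → let t = trip x₂ x₁ x₀ a b n in
        ℚ.∣ first t ∣ ℚ.≤ pow ℓ n ℚ.* k × ℚ.∣ second t ∣ ℚ.≤ pow ℓ (suc n) ℚ.* k ×
        ℚ.∣ third t ∣ ℚ.≤ pow ℓ (suc (suc n)) ℚ.* k
      ∣trip∣≤ zero    = ≤*pow 0 x₂≤ , ≤*pow 1 x₁≤ , ≤*pow 2 x₀≤
      ∣trip∣≤ (suc n) with ∣trip∣≤ n
      ... | u , v , w = v , w , ℚ.≤-trans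
        (∣+∣≤ {a (suc n) ℚ.* third t ℚ.+ b (suc n) ℚ.* second t} {first t}
          (∣+∣≤ {a (suc n) ℚ.* third t} {b (suc n) ℚ.* second t}
            (∣*∣≤ {a (suc n)} {third t} (∣a∣≤ (suc n)) w)
            (∣*∣≤ {b (suc n)} {second t} (∣b∣≤ (suc n)) v)) u)
        (subst₂ ℚ._≤_ (lem₁ (½ ℚ.* P) ℓ (pow ℓ n) k)
          (trans (characteristic (pow ℓ n ℚ.* k)) (lem₂ ℓ (pow ℓ n) k))
          (x≤x+y _ (R ℚ.* (pow ℓ n ℚ.* k)) (0≤* 0≤R (0≤* (0≤pow 0≤ℓ n) 0≤k))))
        where
        t = trip x₂ x₁ x₀ a b n
        lem₁ : ∀ h l w k → h ℚ.* (l ℚ.* (l ℚ.* (w ℚ.* k))) ℚ.+ h ℚ.* (l ℚ.* (w ℚ.* k)) ℚ.+ w ℚ.* k ≡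
          h ℚ.* (l ℚ.* (l ℚ.* w) ℚ.* k) ℚ.+ h ℚ.* (l ℚ.* w ℚ.* k) ℚ.+ w ℚ.* k
        lem₁ = solve-∀ ℚ-ring
        lem₂ : ∀ l w k → l ℚ.* (l ℚ.* (l ℚ.* (w ℚ.* k))) ≡ l ℚ.* (l ℚ.* (l ℚ.* w)) ℚ.* k
        lem₂ = solve-∀ ℚ-ring

    private
      -- Bernoulli's inequality (P/ℓ)^t ≥ 1 + t/(2ℓ), from P = ℓ + ½, multiplied by ℓ^(t+1) to avoid
      -- division. The induction step drops the term t ℓ^t / 4.
      bernoulli : ∀ t → (ℓ ℚ.+ ½ ℚ.* ι (+ t)) ℚ.* pow ℓ t ℚ.≤ ℓ ℚ.* pow P t
      bernoulli zero    = ℚ.≤-reflexive (lem ℓ)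
        where
        lem : ∀ l → (l ℚ.+ ½ ℚ.* 0ℚ) ℚ.* 1ℚ ≡ l ℚ.* 1ℚ
        lem = solve-∀ ℚ-ring
      bernoulli (suc t) = ℚ.≤-trans
        (subst₂ ℚ._≤_ (ℚ.+-identityʳ _) eq
          (ℚ.+-monoʳ-≤ ((ℓ ℚ.+ ½ ℚ.* ι (+ suc t)) ℚ.* (ℓ ℚ.* pow ℓ t))
            (0≤* (0≤* (ℚ.nonNegative⁻¹ (½ ℚ.* ½)) (ι-mono-≤ (ℤ.+≤+ (ℕ.z≤n {t})))) (0≤pow 0≤ℓ t))))
        (subst (P ℚ.* ((ℓ ℚ.+ ½ ℚ.* ι (+ t)) ℚ.* pow ℓ t) ℚ.≤_) (lem₂ P ℓ (pow P t))
          (ℚ.*-monoˡ-≤-nonNeg P {{ℚ.nonNegative 0≤P}} (bernoulli t)))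
        where
        lem₁ : ∀ P t w → (P ℚ.- ½ ℚ.+ ½ ℚ.* (1ℚ ℚ.+ t)) ℚ.* ((P ℚ.- ½) ℚ.* w) ℚ.+ ½ ℚ.* ½ ℚ.* t ℚ.* w ≡
          P ℚ.* ((P ℚ.- ½ ℚ.+ ½ ℚ.* t) ℚ.* w)
        lem₁ = solve-∀ ℚ-ring
        lem₂ : ∀ P l w → P ℚ.* (l ℚ.* w) ≡ l ℚ.* (P ℚ.* w)
        lem₂ = solve-∀ ℚ-ring
        eq : (ℓ ℚ.+ ½ ℚ.* ι (+ suc t)) ℚ.* (ℓ ℚ.* pow ℓ t) ℚ.+ ½ ℚ.* ½ ℚ.* ι (+ t) ℚ.* pow ℓ t ≡
          P ℚ.* ((ℓ ℚ.+ ½ ℚ.* ι (+ t)) ℚ.* pow ℓ t)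
        eq = trans (cong (λ z → (ℓ ℚ.+ ½ ℚ.* z) ℚ.* (ℓ ℚ.* pow ℓ t) ℚ.+ ½ ℚ.* ½ ℚ.* ι (+ t) ℚ.* pow ℓ t)
          (ι-+ 1ℤ (+ t))) (lem₁ P (ι (+ t)) (pow ℓ t))

    pow-P-dominates : ∀ k → ∃ λ t₀ → ∀ t → t₀ ≤ t → ¬ (pow P t ℚ.≤ k ℚ.* pow ℓ t)
    -- From t ≥ q = 2ℓk follows ℓ + t/2 ≥ ℓ + ℓk. With `bernoulli` the assumed inequality then
    -- leaves ℓ^(t+1) ≤ 0.
    pow-P-dominates k = ℤ.∣ ↥ q ∣ , λ t t₀≤t P^t≤ → 1≰0 (ℚ.≤-trans (1≤pow-ℓ (suc t))
      (subst₂ ℚ._≤_ (lem₁ ℓ k (pow ℓ t)) (ℚ.+-inverseʳ (ℓ ℚ.* (k ℚ.* pow ℓ t)))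
        (ℚ.+-monoˡ-≤ (ℚ.- (ℓ ℚ.* (k ℚ.* pow ℓ t)))
          (ℚ.≤-trans (ℚ.*-monoʳ-≤-nonNeg (pow ℓ t) {{ℚ.nonNegative (0≤pow 0≤ℓ t)}}
            (ℚ.+-monoʳ-≤ ℓ (ℚ.*-monoˡ-≤-nonNeg ½ (ℚ.≤-trans (archimedean q) (ι-mono-≤ (ℤ.+≤+ t₀≤t))))))
          (ℚ.≤-trans (bernoulli t) (ℚ.*-monoˡ-≤-nonNeg ℓ {{ℚ.nonNegative 0≤ℓ}} P^t≤))))))
      where
      q : ℚ
      q = (1ℚ ℚ.+ 1ℚ) ℚ.* (ℓ ℚ.* k)
      lem₁ : ∀ l k w → (l ℚ.+ ½ ℚ.* ((1ℚ ℚ.+ 1ℚ) ℚ.* (l ℚ.* k))) ℚ.* w ℚ.- l ℚ.* (k ℚ.* w) ≡ l ℚ.* w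
      lem₁ = solve-∀ ℚ-ring

-- Properties of all sufficiently late approximations

record Eventually (Q : ℕ → Set) : Set where
  constructor from
  field
    start : ℕ
    holds : ∀ m → start ≤ m → Q m
open Eventually

ev-pure : ∀ {Q} → (∀ m → Q m) → Eventually Q
ev-pure q = from 0 (λ m _ → q m)

ev-map : ∀ {Q R} → (∀ {m} → Q m → R m) → Eventually Q → Eventually R
ev-map f (from M q) = from M (λ m M≤m → f (q m M≤m))

ev-zip : ∀ {Q R S} → (∀ {m} → Q m → R m → S m) → Eventually Q → Eventually R → Eventually S
ev-zip f (from M q) (from N r) = from (M ℕ.+ N) λ m M+N≤m →
  f (q m (ℕ.≤-trans (ℕ.m≤m+n M N) M+N≤m)) (r m (ℕ.≤-trans (ℕ.m≤n+m N M) M+N≤m))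

-- A statement about fixed rationals may be proved at any one sufficiently good approximation of the
-- p-adic numbers involved.
ev-extract : ∀ {A : Set} → Eventually (λ _ → A) → A
ev-extract (from M q) = q M ℕ.≤-refl

-- The expansion

module Expansion (p : ℕ) (pr : Prime p) (α β : Seq) (a b : ℕ → ℚ) (αs βs : ℕ → Seq)
  (mcf : IsMCF p α β a b αs βs) where

  open Valuation p pr
  open IsMCF mcf

  -- Null sequences, that is, representatives of 0 in ℚ_p. The exponent is an integer so that bounds
  -- can be shifted freely.
  Tiny : Seq → Set
  Tiny x = ∀ N → Eventually (λ m → VG (x m) N)

  Bounded : Seq → Set
  Bounded x = ∃ λ N → Eventually (λ m → VG (x m) N)

  ≈⇒Tiny : ∀ x y → x ≈[ p ] y → Tiny (x ⊖ y)
  ≈⇒Tiny x y x≈y N with x≈y ℤ.∣ N ∣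
  ... | M , h = from M (λ m M≤m → VG-mono (i≤+∣i∣ N) (ValGe⇒VG (h m M≤m)))

  Tiny-+ : ∀ {x y} → Tiny x → Tiny y → Tiny (λ m → x m ℚ.+ y m)
  Tiny-+ s t N = ev-zip VG-+ (s N) (t N)

  Tiny-*-Bounded : ∀ {x y} → Tiny x → Bounded y → Tiny (x ⊗ y)
  Tiny-*-Bounded {x} {y} t (K , h) N = ev-zip
    (λ {m} u v → subst (VG (x m ℚ.* y m)) (lem N K) (VG-* u v)) (t (N ℤ.- K)) h
    where
    lem : ∀ N K → N ℤ.- K ℤ.+ K ≡ N
    lem = ℤ.solve-∀

  Bounded-const : ∀ q → Bounded (const q)
  Bounded-const q with q ℚ.≟ 0ℚ
  ... | yes refl = 0ℤ , ev-pure (λ _ → VG-0 0ℤ)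
  ... | no q≢0   = νℚ p q , ev-pure (λ _ → Val⇒VG (Val-ν q≢0))

  Bounded-cong : ∀ {x y : Seq} → (∀ m → x m ≡ y m) → Bounded x → Bounded y
  Bounded-cong x≡y (N , h) = N , ev-map (λ {m} → subst (λ z → VG z N) (x≡y m)) h

  Bounded-- : ∀ {x y} → Bounded x → Bounded y → Bounded (x ⊖ y)
  Bounded-- (M , s) (N , t) = M ℤ.⊓ N , ev-zip
    (λ u v → VG-- (VG-mono (ℤ.i⊓j≤i M N) u) (VG-mono (ℤ.i⊓j≤j M N) v)) s t

  Bounded-* : ∀ {x y} → Bounded x → Bounded y → Bounded (x ⊗ y)
  Bounded-* (M , s) (N , t) = M ℤ.+ N , ev-zip VG-* s t

  -- Valuations of the remainders and partial quotients

  γ δ : ℕ → Seq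
  γ k m = αs k m ℚ.- a k
  δ k m = βs k m ℚ.- b k

  γ≥1 : ∀ k → Eventually (λ m → VG (γ k m) 1ℤ)
  γ≥1 k with a-s k
  ... | _ , _ , _ , _ , M , h = from M (λ m M≤m → ValGe⇒VG (h m M≤m))

  δ≥1 : ∀ k → Eventually (λ m → VG (δ k m) 1ℤ)
  δ≥1 k with b-s k
  ... | _ , _ , _ , _ , M , h = from M (λ m M≤m → ValGe⇒VG (h m M≤m))

  -- The recursions of the algorithm hold only up to null sequences; these are the defects.
  εα εβ : ℕ → Seq
  εα k m = αs (suc k) m ℚ.- inv (δ k m)
  εβ k m = βs (suc k) m ℚ.- γ k m ℚ.* inv (δ k m)

  εα-tiny : ∀ k → Tiny (εα k)
  εα-tiny k = ≈⇒Tiny (αs (suc k)) (invS (δ k)) (step-α k)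

  εβ-tiny : ∀ k → Tiny (εβ k)
  εβ-tiny k = ≈⇒Tiny (βs (suc k)) (γ k ⊗ invS (δ k)) (step-β k)

  private
    inv-δ-near-a : ∀ k → Eventually (λ m → VG (inv (δ k m) ℚ.- a (suc k)) 1ℤ)
    inv-δ-near-a k = ev-zip
      (λ {m} u v → subst (λ z → VG z 1ℤ) (lem (αs (suc k) m) (a (suc k)) (inv (δ k m))) (VG-- u v))
      (γ≥1 (suc k)) (εα-tiny k 1ℤ)
      where
      lem : ∀ x a i → (x ℚ.- a) ℚ.- (x ℚ.- i) ≡ i ℚ.- a
      lem = solve-∀ ℚ-ring

    move : ∀ a i → a ℚ.+ (i ℚ.- a) ≡ i
    move = solve-∀ ℚ-ring

  -- Otherwise 1/δ would have positive valuation, like δ itself, which forces δ = 0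
  -- eventually: the algorithm would have stopped.
  ¬VG-a-1 : ∀ k → ¬ VG (a (suc k)) 1ℤ
  ¬VG-a-1 k A = nonstop k (λ N → start δ≡0 , λ m M≤m → inj₁ (holds δ≡0 m M≤m))
    where
    δ≡0 : Eventually (λ m → δ k m ≡ 0ℚ)
    δ≡0 = ev-zip vanishes (δ≥1 k) (inv-δ-near-a k)
      where
      vanishes : ∀ {m} → VG (δ k m) 1ℤ → VG (inv (δ k m) ℚ.- a (suc k)) 1ℤ → δ k m ≡ 0ℚ
      vanishes {m} u v = decidable-stable (δ k m ℚ.≟ 0ℚ) (λ δ≢0 → ¬Val∧VG-suc Val-1 (VG-mono (ℤ.+≤+ (ℕ.s≤s ℕ.z≤n))
        (subst (λ z → VG z (+ 2)) (inv-inverseʳ δ≢0)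
          (VG-* u (subst (λ z → VG z 1ℤ) (move (a (suc k)) (inv (δ k m))) (VG-+ A v))))))

  -- κ k is the paper's k_{k+1}.
  κ : ℕ → ℤ
  κ k = kk p a (suc k)

  private
    inv-involutive : ∀ {x} → x ≢ 0ℚ → inv (inv x) ≡ x
    inv-involutive {x} x≢0 = inv-unique {inv x} (trans (ℚ.*-comm (inv x) x) (inv-inverseʳ x≢0))

    inv≢0 : ∀ {x} → x ≢ 0ℚ → inv x ≢ 0ℚ
    inv≢0 {x} x≢0 e = ℚ.1≢0 (trans (sym (inv-inverseʳ x≢0)) (trans (cong (x ℚ.*_) e) (ℚ.*-zeroʳ x)))

    a≢0 : ∀ k → a (suc k) ≢ 0ℚ
    a≢0 k e = ¬VG-a-1 k (subst (λ z → VG z 1ℤ) (sym e) (VG-0 1ℤ))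

  Val-inv-a : ∀ k → Val (inv (a (suc k))) (κ k)
  Val-inv-a k = Val-ν (inv≢0 (a≢0 k))

  Val-a : ∀ k → Val (a (suc k)) (ℤ.- κ k)
  Val-a k = subst (λ z → Val z (ℤ.- κ k)) (inv-involutive (a≢0 k)) (Val-inv (Val-inv-a k))

  -- A preliminary bound, just enough for `Val-δ`, from which the sharper `1≤κ` follows.
  0≤κ : ∀ k → 0ℤ ℤ.≤ κ k
  0≤κ k with 0ℤ ℤ.≤? κ k
  ... | yes 0≤κ = 0≤κ
  ... | no  0≰κ = ⊥-elim (¬VG-a-1 k (VG-mono
      (ℤ.neg-mono-≤ (ℤ.i<j⇒i≤pred[j] (ℤ.≰⇒> 0≰κ))) (Val⇒VG (Val-a k))))

  -- 1/δ_k is a_(k+1) plus a term of valuation at least 1, while ν(a_(k+1)) = -κ_k ≤ 0. Hence 1/δ_k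
  -- inherits the valuation of a_(k+1).
  Val-δ : ∀ k → Eventually (λ m → Val (δ k m) (κ k))
  Val-δ k = ev-map convert (inv-δ-near-a k)
    where
    -κ+1≤1 : ℤ.- κ k ℤ.+ 1ℤ ℤ.≤ 1ℤ
    -κ+1≤1 = ≤-from-diff (κ k) (0≤κ k) (lem (κ k))
      where
      lem : ∀ i → 1ℤ ≡ ℤ.- i ℤ.+ 1ℤ ℤ.+ i
      lem = ℤ.solve-∀
    convert : ∀ {m} → VG (inv (δ k m) ℚ.- a (suc k)) 1ℤ → Val (δ k m) (κ k)
    convert {m} v = subst₂ Val (inv-involutive δ≢0) (ℤ.neg-involutive (κ k)) (Val-inv Val-inv-δ)
      where
      Val-inv-δ : Val (inv (δ k m)) (ℤ.- κ k)
      Val-inv-δ = subst (λ z → Val z (ℤ.- κ k)) (move (a (suc k)) (inv (δ k m)))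
        (Val-+ (Val-a k) (VG-mono -κ+1≤1 v))
      -- By the convention `inv 0ℚ = 0ℚ`, a vanishing δ would make its inverse vanish, which has a
      -- finite valuation.
      δ≢0 : δ k m ≢ 0ℚ
      δ≢0 e = Val⇒≢0 Val-inv-δ (cong inv e)

  VG-inv-δ : ∀ k → Eventually (λ m → VG (inv (δ k m)) (ℤ.- κ k))
  VG-inv-δ k = ev-map (Val⇒VG ∘ Val-inv) (Val-δ k)

  1≤κ : ∀ k → 1ℤ ℤ.≤ κ k
  1≤κ k with 1ℤ ℤ.≤? κ k
  ... | yes 1≤κ = 1≤κ
  ... | no  1≰κ = ⊥-elim (ev-extract (ev-zip
    (λ u v → ¬Val∧VG-suc v (VG-mono κ+1≤1 u)) (δ≥1 k) (Val-δ k)))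
    where
    κ+1≤1 : κ k ℤ.+ 1ℤ ℤ.≤ 1ℤ
    κ+1≤1 = subst (ℤ._≤ 1ℤ) (ℤ.+-comm 1ℤ (κ k)) (ℤ.i<j⇒suc[i]≤j (ℤ.≰⇒> 1≰κ))

  private
    0<κ-diff : ∀ k → 0ℤ ℤ.≤ κ k ℤ.- 1ℤ
    0<κ-diff k = ℤ.i≤j⇒0≤j-i (1≤κ k)

  -- Modulo valuation 1 and a null sequence, b_(k+1) is γ_k/δ_k, and ν(γ_k) ≥ 1. So b_(k+1) has
  -- strictly larger valuation than a_(k+1).
  VG-b : ∀ k → VG (b (suc k)) (1ℤ ℤ.- κ k)
  VG-b k = ev-extract (ev-zip
    (λ {m} u v → subst (λ z → VG z (1ℤ ℤ.- κ k))
      (lem (βs (suc k) m) (b (suc k)) (γ k m ℚ.* inv (δ k m)))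
      (VG-- u (VG-mono 1-κ≤1 v)))
    (ev-zip VG-+ (εβ-tiny k (1ℤ ℤ.- κ k)) (ev-zip VG-* (γ≥1 k) (VG-inv-δ k)))
    (δ≥1 (suc k)))
    where
    1-κ≤1 : 1ℤ ℤ.- κ k ℤ.≤ 1ℤ
    1-κ≤1 = ≤-from-diff (κ k) (0≤κ k) (lem (κ k))
      where
      lem : ∀ i → 1ℤ ≡ 1ℤ ℤ.- i ℤ.+ i
      lem = ℤ.solve-∀
    lem : ∀ x b g → (x ℚ.- g) ℚ.+ g ℚ.- (x ℚ.- b) ≡ b
    lem = solve-∀ ℚ-ring

  -- γ_k is δ_k β_(k+1) up to a null sequence; write β_(k+1) as a (b/a) plus its remainder. As δ_k
  -- a_(k+1) has valuation 0, the first term has the valuation of b/a. The second reaches κ_k + 1,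
  -- which `z ≤ κ k` makes sufficient.
  VG-γ : ∀ k z → VG (b (suc k) ℚ.* inv (a (suc k))) z → z ℤ.≤ κ k →
    Eventually (λ m → VG (γ k m) z)
  VG-γ k z B z≤κ = ev-zip
    (λ {m} D u → subst (λ x → VG x z) (eq {m} D)
      (VG-+ (subst (VG (δ k m ℚ.* a (suc k) ℚ.* (b (suc k) ℚ.* inv (a (suc k)))))
              (lem₁ (κ k) z) (VG-* (VG-* (Val⇒VG D) (Val⇒VG (Val-a k))) B))
            (VG-mono z≤κ+1 (VG-* (Val⇒VG D) u))))
    (Val-δ k) (ev-zip VG-- (δ≥1 (suc k)) (εβ-tiny k 1ℤ))
    where
    open ≡-Reasoning
    lem₁ : ∀ k z → k ℤ.+ (ℤ.- k) ℤ.+ z ≡ z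
    lem₁ = ℤ.solve-∀
    z≤κ+1 : z ℤ.≤ κ k ℤ.+ 1ℤ
    z≤κ+1 = ℤ.≤-trans z≤κ (ℤ.i≤i+j (κ k) 1ℤ)
    lem₂ : ∀ d a b i x g j → d ℚ.* a ℚ.* (b ℚ.* i) ℚ.+ d ℚ.* (x ℚ.- b ℚ.- (x ℚ.- g ℚ.* j)) ≡
      d ℚ.* j ℚ.* g ℚ.+ d ℚ.* b ℚ.* (a ℚ.* i ℚ.- 1ℚ)
    lem₂ = solve-∀ ℚ-ring
    lem₃ : ∀ g c → 1ℚ ℚ.* g ℚ.+ c ℚ.* (1ℚ ℚ.- 1ℚ) ≡ g
    lem₃ = solve-∀ ℚ-ring
    eq : ∀ {m} → Val (δ k m) (κ k) →
      δ k m ℚ.* a (suc k) ℚ.* (b (suc k) ℚ.* inv (a (suc k))) ℚ.+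
        δ k m ℚ.* (δ (suc k) m ℚ.- εβ k m) ≡ γ k m
    eq {m} D = begin
      _ ≡⟨ lem₂ (δ k m) (a (suc k)) (b (suc k)) (inv (a (suc k))) (βs (suc k) m) (γ k m) (inv (δ k m)) ⟩
      δ k m ℚ.* inv (δ k m) ℚ.* γ k m ℚ.+ δ k m ℚ.* b (suc k) ℚ.* (a (suc k) ℚ.* inv (a (suc k)) ℚ.- 1ℚ)
        ≡⟨ cong₂ (λ u v → u ℚ.* γ k m ℚ.+ δ k m ℚ.* b (suc k) ℚ.* (v ℚ.- 1ℚ))
             (inv-inverseʳ (Val⇒≢0 D)) (inv-inverseʳ (a≢0 k)) ⟩
      1ℚ ℚ.* γ k m ℚ.+ δ k m ℚ.* b (suc k) ℚ.* (1ℚ ℚ.- 1ℚ) ≡⟨ lem₃ (γ k m) (δ k m ℚ.* b (suc k)) ⟩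
      γ k m ∎

  -- Valuation of the denominators C_n

  K : ℕ → ℤ
  K zero    = 0ℤ
  K (suc n) = K n ℤ.+ κ n

  0≤K : ∀ n → 0ℤ ℤ.≤ K n
  0≤K zero    = ℤ.≤-refl
  0≤K (suc n) = ℤ.+-mono-≤ (0≤K n) (0≤κ n)

  C-trip : ℕ → ℚ × ℚ × ℚ
  C-trip = trip 0ℚ 0ℚ 1ℚ a b

  private
    -- In C_(n+1) = a_(n+1) C_n + b_(n+1) C_(n-1) + C_(n-2) the first term strictly dominates, by
    -- `VG-b` and κ ≥ 1. The older entries get lower bounds only, since the initial ones are 0.
    C-invariant : ∀ n → Val (third (C-trip n)) (ℤ.- K n) ×
      VG (second (C-trip n)) (ℤ.- K n) × VG (first (C-trip n)) (ℤ.- K n)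
    C-invariant zero    = Val-1 , VG-0 0ℤ , VG-0 0ℤ
    C-invariant (suc n) with C-invariant n
    ... | w , v , u = subst₂ Val (sym (ℚ.+-assoc
              (a (suc n) ℚ.* third (C-trip n)) (b (suc n) ℚ.* second (C-trip n)) (first (C-trip n)))) (lem₁ (K n) (κ n))
            (Val-+ (Val-* (Val-a n) w)
              (VG-+ (subst (VG (b (suc n) ℚ.* second (C-trip n))) (lem₂ (K n) (κ n)) (VG-* (VG-b n) v))
                    (VG-mono (≤-from-diff (κ n ℤ.- 1ℤ) (0<κ-diff n) (lem₃ (K n) (κ n))) u)))
          , VG-mono dec (Val⇒VG w) , VG-mono dec v
      where
      lem₁ : ∀ K k → ℤ.- k ℤ.+ (ℤ.- K) ≡ ℤ.- (K ℤ.+ k)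
      lem₁ = ℤ.solve-∀
      lem₂ : ∀ K k → 1ℤ ℤ.- k ℤ.+ (ℤ.- K) ≡ ℤ.- k ℤ.+ (ℤ.- K) ℤ.+ 1ℤ
      lem₂ = ℤ.solve-∀
      lem₃ : ∀ K k → ℤ.- K ≡ ℤ.- k ℤ.+ (ℤ.- K) ℤ.+ 1ℤ ℤ.+ (k ℤ.- 1ℤ)
      lem₃ = ℤ.solve-∀
      lem₄ : ∀ K k → ℤ.- K ≡ ℤ.- (K ℤ.+ k) ℤ.+ k
      lem₄ = ℤ.solve-∀
      dec : ℤ.- K (suc n) ℤ.≤ ℤ.- K n
      dec = ≤-from-diff (κ n) (0≤κ n) (lem₄ (K n) (κ n))

  Val-C : ∀ n → Val (Cₙ a b n) (ℤ.- K n)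
  Val-C n = proj₁ (C-invariant n)

  Bounded-limit : ∀ {x y : Seq} {c} → Eventually (λ m → VG (x m ℚ.- c) 1ℤ) → Tiny (x ⊖ y) → Bounded y
  Bounded-limit {x} {y} {c} X t = Bounded-cong (λ m → lem (x m) c (y m))
    (Bounded-- {(x ⊖ const c) ⊖ (x ⊖ y)} {const (ℚ.- c)}
      (Bounded-- {x ⊖ const c} {x ⊖ y} (1ℤ , X) (0ℤ , t 0ℤ)) (Bounded-const (ℚ.- c)))
    where
    lem : ∀ x c y → x ℚ.- c ℚ.- (x ℚ.- y) ℚ.- (ℚ.- c) ≡ y
    lem = solve-∀ ℚ-ring

  α-bounded : Bounded α
  α-bounded = Bounded-limit {αs 0} {α} {a 0} (γ≥1 0) (≈⇒Tiny (αs 0) α init-α)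

  β-bounded : Bounded β
  β-bounded = Bounded-limit {βs 0} {β} {b 0} (δ≥1 0) (≈⇒Tiny (βs 0) β init-β)

  -- X stands for A (θ = α) or B (θ = β); V third n is the error X_n − θ C_n.
  module Approximation (x₂ x₁ x₀ : ℚ) (θ : Seq) (θ-bounded : Bounded θ)
    -- The starting case `T 0`: for A it reduces to α_0 - α, for B to β_0 - β.
    (base : Tiny (λ m → x₀ ℚ.- θ m ℚ.* 1ℚ ℚ.+ γ 0 m ℚ.* (x₁ ℚ.- θ m ℚ.* 0ℚ) ℚ.+
                        δ 0 m ℚ.* (x₂ ℚ.- θ m ℚ.* 0ℚ))) where

    X-trip : ℕ → ℚ × ℚ × ℚ
    X-trip = trip x₂ x₁ x₀ a b

    V : (ℚ × ℚ × ℚ → ℚ) → ℕ → Seq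
    V π n m = π (X-trip n) ℚ.- θ m ℚ.* π (C-trip n)

    V-bounded : ∀ π n → Bounded (V π n)
    V-bounded π n = Bounded-- {const (π (X-trip n))} {θ ⊗ const (π (C-trip n))}
      (Bounded-const (π (X-trip n)))
      (Bounded-* {θ} {const (π (C-trip n))} θ-bounded (Bounded-const (π (C-trip n))))

    T : ℕ → Seq
    T n m = V third n m ℚ.+ γ n m ℚ.* V second n m ℚ.+ δ n m ℚ.* V first n m

    private
      -- Division by δ_n turns γ_n/δ_n into β_(n+1) and 1/δ_n into α_(n+1), up to the defects.
      -- Splitting off a_(n+1) and b_(n+1) then assembles V_(n+1) by its recurrence.
      T-suc : ∀ n {m} → Val (δ n m) (κ n) →
        T n m ℚ.* inv (δ n m) ℚ.+ (εα n m ℚ.* V third n m ℚ.+ εβ n m ℚ.* V second n m) ≡ T (suc n) m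
      T-suc n {m} D = trans
        (lem₁ (αs (suc n) m) (a (suc n)) (βs (suc n) m) (b (suc n)) (γ n m) (δ n m) (inv (δ n m))
          (θ m) (third (X-trip n)) (second (X-trip n)) (first (X-trip n))
          (third (C-trip n)) (second (C-trip n)) (first (C-trip n)))
        (trans (cong (λ z → T (suc n) m ℚ.+ (z ℚ.- 1ℚ) ℚ.* V first n m) (inv-inverseʳ (Val⇒≢0 D)))
          (lem₂ (T (suc n) m) (V first n m)))
        where
        lem₁ : ∀ x a y b g d i t w v u w′ v′ u′ →
          (w ℚ.- t ℚ.* w′ ℚ.+ g ℚ.* (v ℚ.- t ℚ.* v′) ℚ.+ d ℚ.* (u ℚ.- t ℚ.* u′)) ℚ.* i ℚ.+
          ((x ℚ.- i) ℚ.* (w ℚ.- t ℚ.* w′) ℚ.+ (y ℚ.- g ℚ.* i) ℚ.* (v ℚ.- t ℚ.* v′)) ≡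
          (a ℚ.* w ℚ.+ b ℚ.* v ℚ.+ u ℚ.- t ℚ.* (a ℚ.* w′ ℚ.+ b ℚ.* v′ ℚ.+ u′)
            ℚ.+ (x ℚ.- a) ℚ.* (w ℚ.- t ℚ.* w′) ℚ.+ (y ℚ.- b) ℚ.* (v ℚ.- t ℚ.* v′))
          ℚ.+ (d ℚ.* i ℚ.- 1ℚ) ℚ.* (u ℚ.- t ℚ.* u′)
        lem₁ = solve-∀ ℚ-ring
        lem₂ : ∀ t u → t ℚ.+ (1ℚ ℚ.- 1ℚ) ℚ.* u ≡ t
        lem₂ = solve-∀ ℚ-ring

    T-tiny : ∀ n → Tiny (T n)
    T-tiny zero      = base
    T-tiny (suc n) N = ev-zip (λ {m} D v → subst (λ z → VG z N) (T-suc n D) v) (Val-δ n)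
      (Tiny-+ {T n ⊗ invS (δ n)} {λ m → εα n m ℚ.* V third n m ℚ.+ εβ n m ℚ.* V second n m}
        (Tiny-*-Bounded {T n} {invS (δ n)} (T-tiny n) (ℤ.- κ n , VG-inv-δ n))
        (Tiny-+ {εα n ⊗ V third n} {εβ n ⊗ V second n}
          (Tiny-*-Bounded {εα n} {V third n} (εα-tiny n) (V-bounded third n))
          (Tiny-*-Bounded {εβ n} {V second n} (εβ-tiny n) (V-bounded second n))) N)

  -- Growth of the valuations of the errors, with d = D - 1

  module Growth (d N : ℕ)
    (k-growth : ∀ n → N ≤ n →
      + d ℤ.* (κ (suc n) ℤ.+ κ n) ℤ.+ + 2 ℤ.* + suc d ℤ.≤ κ (suc (suc n)))
    (h-growth : ∀ n → N ≤ n → VG (b (suc (suc (suc n))) ℚ.* inv (a (suc (suc (suc n)))))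
      (+ d ℤ.* κ (suc n) ℤ.+ + suc d)) where

    -- The hypothesis on h is exactly the increment of `G` over one step, the one on k its increment
    -- over two steps. They match the factors γ and δ of V_(n-1) and V_(n-2) in `T`.
    G : ℕ → ℤ
    G n = + d ℤ.* K n ℤ.+ + suc d ℤ.* + n

    G-suc : ∀ n → G (suc n) ≡ G n ℤ.+ (+ d ℤ.* κ n ℤ.+ + suc d)
    G-suc n = lem (+ d) (K n) (κ n) (+ suc d) (+ n)
      where
      lem : ∀ d K k D n → d ℤ.* (K ℤ.+ k) ℤ.+ D ℤ.* (1ℤ ℤ.+ n) ≡ d ℤ.* K ℤ.+ D ℤ.* n ℤ.+ (d ℤ.* k ℤ.+ D)
      lem = ℤ.solve-∀

    private
      G-suc-suc : ∀ n → G (suc (suc n)) ≡ + d ℤ.* (κ (suc n) ℤ.+ κ n) ℤ.+ + 2 ℤ.* + suc d ℤ.+ G n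
      G-suc-suc n = trans (G-suc (suc n)) (trans (cong (ℤ._+ (+ d ℤ.* κ (suc n) ℤ.+ + suc d)) (G-suc n))
        (lem (+ d) (κ n) (κ (suc n)) (+ suc d) (G n)))
        where
        lem : ∀ d k k′ D G → G ℤ.+ (d ℤ.* k ℤ.+ D) ℤ.+ (d ℤ.* k′ ℤ.+ D) ≡
          d ℤ.* (k′ ℤ.+ k) ℤ.+ + 2 ℤ.* D ℤ.+ G
        lem = ℤ.solve-∀

      0≤d*κ : ∀ n → 0ℤ ℤ.≤ + d ℤ.* κ n
      0≤d*κ n = subst (ℤ._≤ + d ℤ.* κ n) (ℤ.*-zeroʳ (+ d)) (ℤ.*-monoˡ-≤-nonNeg (+ d) (0≤κ n))

      -- The side condition `z ≤ κ k` of `VG-γ`: the bound required of h lies below the bound on k.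
      γ-exponent≤κ : ∀ n → N ≤ n → + d ℤ.* κ (suc n) ℤ.+ + suc d ℤ.≤ κ (suc (suc n))
      γ-exponent≤κ n N≤n = ℤ.≤-trans
        (≤-from-diff (+ d ℤ.* κ n ℤ.+ + suc d) (ℤ.+-mono-≤ (0≤d*κ n) (ℤ.+≤+ ℕ.z≤n))
          (lem (+ d) (κ n) (κ (suc n)) (+ suc d)))
        (k-growth n N≤n)
        where
        lem : ∀ d k k′ D → d ℤ.* (k′ ℤ.+ k) ℤ.+ + 2 ℤ.* D ≡ d ℤ.* k′ ℤ.+ D ℤ.+ (d ℤ.* k ℤ.+ D)
        lem = ℤ.solve-∀

    0≤G : ∀ n → 0ℤ ℤ.≤ G n
    0≤G zero    = ℤ.≤-reflexive (sym (lem (+ d) (+ suc d)))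
      where
      lem : ∀ d D → d ℤ.* 0ℤ ℤ.+ D ℤ.* 0ℤ ≡ 0ℤ
      lem = ℤ.solve-∀
    0≤G (suc n) = subst (0ℤ ℤ.≤_) (sym (G-suc n))
      (ℤ.+-mono-≤ (0≤G n) (ℤ.+-mono-≤ (0≤d*κ n) (ℤ.+≤+ (ℕ.z≤n {suc d}))))

    module _ (x₂ x₁ x₀ : ℚ) (θ : Seq) (θ-bounded : Bounded θ)
      (base : Tiny (λ m → x₀ ℚ.- θ m ℚ.* 1ℚ ℚ.+ γ 0 m ℚ.* (x₁ ℚ.- θ m ℚ.* 0ℚ) ℚ.+
                          δ 0 m ℚ.* (x₂ ℚ.- θ m ℚ.* 0ℚ))) where

      open Approximation x₂ x₁ x₀ θ θ-bounded base

      V-growth : ∃ λ c → ∀ n → N ≤ n → Eventually (λ m → VG (V third n m) (G n ℤ.- + c))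
      V-growth = c , λ n N≤n → subst (λ n → Eventually (λ m → VG (V third n m) (G n ℤ.- + c)))
          (ℕ.m∸n+n≡m N≤n) (proj₁ (go (n ℕ.∸ N)))
        where
        z₀ z₁ : ℤ
        z₀ = proj₁ (V-bounded third N)
        z₁ = proj₁ (V-bounded third (suc N))
        -- Large enough for the claim to hold at both starting indices of the two-step induction,
        -- `N` and `suc N`.
        c : ℕ
        c = ℤ.∣ G N ℤ.- z₀ ∣ ℕ.+ ℤ.∣ G (suc N) ℤ.- z₁ ∣

        below : ∀ g z → ℤ.∣ g ℤ.- z ∣ ℕ.≤ c → g ℤ.- + c ℤ.≤ z
        below g z ≤c = ≤-from-diff (+ c ℤ.- (g ℤ.- z))
          (ℤ.i≤j⇒0≤j-i (ℤ.≤-trans (i≤+∣i∣ (g ℤ.- z)) (ℤ.+≤+ ≤c))) (lem g z (+ c))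
          where
          lem : ∀ g z c → z ≡ g ℤ.- c ℤ.+ (c ℤ.- (g ℤ.- z))
          lem = ℤ.solve-∀

        step : ∀ n → N ≤ n →
          Eventually (λ m → VG (V third n m) (G n ℤ.- + c)) →
          Eventually (λ m → VG (V third (suc n) m) (G (suc n) ℤ.- + c)) →
          Eventually (λ m → VG (V third (suc (suc n)) m) (G (suc (suc n)) ℤ.- + c))
        -- `T n+2` is solved for its leading term. Its `second` and `first` entries are, by
        -- computation, the `third` entries at `suc n` and `n`.
        step n N≤n v₀ v₁ = ev-zip
          (λ {m} t s → subst (λ z → VG z (G n+2 ℤ.- + c))
            (lem (V third n+2 m) (γ n+2 m ℚ.* V third (suc n) m) (δ n+2 m ℚ.* V third n m))
            (VG-- t s))
          (T-tiny n+2 (G n+2 ℤ.- + c))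
          (ev-zip VG-+
            (ev-zip (λ {m} u v → subst (VG (γ n+2 m ℚ.* V third (suc n) m)) eq-γ (VG-* u v))
              (VG-γ n+2 _ (h-growth n N≤n) (γ-exponent≤κ n N≤n)) v₁)
            (ev-zip (λ {m} D v → VG-mono ≤-δ (VG-* (Val⇒VG D) v)) (Val-δ n+2) v₀))
          where
          n+2 = suc (suc n)
          lem : ∀ v x y → v ℚ.+ x ℚ.+ y ℚ.- (x ℚ.+ y) ≡ v
          lem = solve-∀ ℚ-ring
          eq-γ : + d ℤ.* κ (suc n) ℤ.+ + suc d ℤ.+ (G (suc n) ℤ.- + c) ≡ G n+2 ℤ.- + c
          eq-γ = trans (lem₁ (+ d ℤ.* κ (suc n) ℤ.+ + suc d) (G (suc n)) (+ c))
            (cong (ℤ._- + c) (sym (G-suc (suc n))))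
            where
            lem₁ : ∀ z g c → z ℤ.+ (g ℤ.- c) ≡ g ℤ.+ z ℤ.- c
            lem₁ = ℤ.solve-∀
          ≤-δ : G n+2 ℤ.- + c ℤ.≤ κ n+2 ℤ.+ (G n ℤ.- + c)
          ≤-δ = subst₂ ℤ._≤_ (cong (ℤ._- + c) (sym (G-suc-suc n))) (ℤ.+-assoc (κ n+2) (G n) (ℤ.- + c))
            (ℤ.+-monoˡ-≤ (ℤ.- + c) (ℤ.+-monoˡ-≤ (G n) (k-growth n N≤n)))

        go : ∀ j → Eventually (λ m → VG (V third (j ℕ.+ N) m) (G (j ℕ.+ N) ℤ.- + c)) ×
                   Eventually (λ m → VG (V third (suc (j ℕ.+ N)) m) (G (suc (j ℕ.+ N)) ℤ.- + c))
        go zero    =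
          ev-map (VG-mono (below (G N) z₀ (ℕ.m≤m+n _ _))) (proj₂ (V-bounded third N)) ,
          ev-map (VG-mono (below (G (suc N)) z₁ (ℕ.m≤n+m _ _))) (proj₂ (V-bounded third (suc N)))
        go (suc j) with go j
        ... | v₀ , v₁ = v₁ , step (j ℕ.+ N) (ℕ.m≤n+m N j) v₀ v₁

    A-growth : ∃ λ c → ∀ n → N ≤ n →
      Eventually (λ m → VG (Aₙ a b n ℚ.- α m ℚ.* Cₙ a b n) (G n ℤ.- + c))
    A-growth = V-growth 0ℚ 1ℚ (a 0) α α-bounded
      (λ M → ev-map (λ {m} → subst (λ z → VG z M) (lem (αs 0 m) (a 0) (α m) (δ 0 m)))
        (≈⇒Tiny (αs 0) α init-α M))
      where
      lem : ∀ x a θ d → x ℚ.- θ ≡ a ℚ.- θ ℚ.* 1ℚ ℚ.+ (x ℚ.- a) ℚ.* (1ℚ ℚ.- θ ℚ.* 0ℚ) ℚ.+ d ℚ.* (0ℚ ℚ.- θ ℚ.* 0ℚ)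
      lem = solve-∀ ℚ-ring

    B-growth : ∃ λ c → ∀ n → N ≤ n →
      Eventually (λ m → VG (Bₙ a b n ℚ.- β m ℚ.* Cₙ a b n) (G n ℤ.- + c))
    B-growth = V-growth 1ℚ 0ℚ (b 0) β β-bounded
      (λ M → ev-map (λ {m} → subst (λ z → VG z M) (lem (βs 0 m) (b 0) (β m) (γ 0 m)))
        (≈⇒Tiny (βs 0) β init-β M))
      where
      lem : ∀ x b θ g → x ℚ.- θ ≡ b ℚ.- θ ℚ.* 1ℚ ℚ.+ g ℚ.* (0ℚ ℚ.- θ ℚ.* 0ℚ) ℚ.+ (x ℚ.- b) ℚ.* (1ℚ ℚ.- θ ℚ.* 0ℚ)
      lem = solve-∀ ℚ-ring

  -- Vanishing of F at the convergents

  module Vanishing (p≢2 : ¬ (p ≡ 2)) (F : Poly) (F≈0 : evalSeq F α β ≈[ p ] const 0ℚ) where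

    F-tiny : Tiny (evalSeq F α β)
    F-tiny N = ev-map (λ {m} → subst (λ z → VG z N) (ℚ.+-identityʳ (evalSeq F α β m)))
      (≈⇒Tiny (evalSeq F α β) (const 0ℚ) F≈0 N)

    -- The value is one rational, the same at every point. Since F(α, β) = 0 it has arbitrarily
    -- large valuation, which a non-zero rational cannot have.
    constant-case : (∀ i j → ¬ (coeff F i j ≡ 0ℚ) → i ℕ.+ j ≤ 0) → ∀ x y → evalℚ F x y ≡ 0ℚ
    constant-case degree x y = decidable-stable (evalℚ F x y ℚ.≟ 0ℚ) λ ne →
      ev-extract (ev-map
        (λ {m} v → ¬Val∧VG-suc (Val-ν ne)
          (subst (λ z → VG z (νℚ p (evalℚ F x y) ℤ.+ 1ℤ)) (evalℚ-constant F degree (α m) (β m) x y) v))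
        (F-tiny (νℚ p (evalℚ F x y) ℤ.+ 1ℤ)))

    private
      PInt-s : ∀ θ {q} → IsS p θ q → PInt q
      PInt-s _ (m , d , _ , e , _) = subst PInt (sym e) (PInt-digitSum m d)

      ∣s∣≤P/2 : ∀ θ {q} → IsS p θ q → ℚ.∣ q ∣ ℚ.≤ ½ ℚ.* P
      ∣s∣≤P/2 _ (m , d , bal , e , _) =
        subst (λ z → ℚ.∣ z ∣ ℚ.≤ ½ ℚ.* P) (sym e) (∣digits∣≤P/2 (suc m) d bal)

      A B C : ℕ → ℚ
      A = Aₙ a b
      B = Bₙ a b
      C = Cₙ a b

      PInt-X : ∀ {x₂ x₁ x₀} → PInt x₂ → PInt x₁ → PInt x₀ → ∀ n → PInt (third (trip x₂ x₁ x₀ a b n))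
      PInt-X X₂ X₁ X₀ n = proj₂ (proj₂ (PInt-trip X₂ X₁ X₀ (λ k → PInt-s (αs k) (a-s k)) (λ k → PInt-s (βs k) (b-s k)) n))

    module Positive-degree (d N : ℕ) (degree : ∀ i j → ¬ (coeff F i j ≡ 0ℚ) → i ℕ.+ j ≤ suc d)
      (k-growth : ∀ n → N ≤ n →
        + d ℤ.* (κ (suc n) ℤ.+ κ n) ℤ.+ + 2 ℤ.* + suc d ℤ.≤ κ (suc (suc n)))
      (h-growth : ∀ n → N ≤ n → VG (b (suc (suc (suc n))) ℚ.* inv (a (suc (suc (suc n)))))
        (+ d ℤ.* κ (suc n) ℤ.+ + suc d))
      (M : ℤ) (M≢0 : M ≢ 0ℤ) (c-integer : ∀ i j → IsInteger (ι M ℚ.* coeff F i j)) where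

      D : ℕ
      D = suc d

      open Homogenisation F D degree M
      open Growth d N k-growth h-growth
      open Size p≢2

      h : ℕ → ℚ
      h n = H (A n) (B n) (C n)

      private
        -- `c₀` covers the losses in both error bounds and `s` the possibly negative valuations of α
        -- and β. `L` contains `c₀` because A_n and B_n are bounded as C_n α and C_n β plus an error
        -- of valuation at least -c₀.
        cA cB c₀ s e : ℕ
        cA = proj₁ A-growth
        cB = proj₁ B-growth
        c₀ = cA ℕ.+ cB
        s  = ℤ.∣ proj₁ α-bounded ∣ ℕ.+ ℤ.∣ proj₁ β-bounded ∣
        e  = c₀ ℕ.+ d ℕ.* (c₀ ℕ.+ s)

        L E : ℕ → ℤ
        L n = K n ℤ.+ + (c₀ ℕ.+ s)
        E n = G n ℤ.- + c₀

        -L≤-K : ∀ n → ℤ.- L n ℤ.≤ ℤ.- K n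
        -L≤-K n = ≤-from-diff (+ (c₀ ℕ.+ s)) (ℤ.+≤+ ℕ.z≤n) (lem (K n) (+ (c₀ ℕ.+ s)))
          where
          lem : ∀ K c → ℤ.- K ≡ ℤ.- (K ℤ.+ c) ℤ.+ c
          lem = ℤ.solve-∀

        -L≤-K+z : ∀ n z → ℤ.∣ z ∣ ≤ s → ℤ.- L n ℤ.≤ ℤ.- K n ℤ.+ z
        -L≤-K+z n z z≤s = ≤-from-diff (+ c₀ ℤ.+ (+ s ℤ.+ z))
          (ℤ.+-mono-≤ (ℤ.+≤+ (ℕ.z≤n {c₀})) (0≤s+z z z≤s)) (lem (K n) (+ c₀) (+ s) z)
          where
          lem : ∀ K c s z → ℤ.- K ℤ.+ z ≡ ℤ.- (K ℤ.+ (c ℤ.+ s)) ℤ.+ (c ℤ.+ (s ℤ.+ z))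
          lem = ℤ.solve-∀
          0≤s+z : ∀ z → ℤ.∣ z ∣ ≤ s → 0ℤ ℤ.≤ + s ℤ.+ z
          0≤s+z (+ n)    _   = ℤ.+≤+ ℕ.z≤n
          0≤s+z -[1+ n ] n≤s = subst (0ℤ ℤ.≤_) (sym (ℤ.⊖-≥ n≤s)) (ℤ.+≤+ ℕ.z≤n)

        E≤ : ∀ n c → c ≤ c₀ → E n ℤ.≤ G n ℤ.- + c
        E≤ n c c≤c₀ = ℤ.+-monoʳ-≤ (G n) (ℤ.neg-mono-≤ (ℤ.+≤+ c≤c₀))

        -L≤E : ∀ n → ℤ.- L n ℤ.≤ E n
        -L≤E n = ≤-from-diff (K n ℤ.+ (G n ℤ.+ + s))
          (ℤ.+-mono-≤ (0≤K n) (ℤ.+-mono-≤ (0≤G n) (ℤ.+≤+ (ℕ.z≤n {s})))) (lem (K n) (G n) (+ c₀) (+ s))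
          where
          lem : ∀ K G c s → G ℤ.- c ≡ ℤ.- (K ℤ.+ (c ℤ.+ s)) ℤ.+ (K ℤ.+ (G ℤ.+ s))
          lem = ℤ.solve-∀

        close-X : ∀ n {x t c z} → VG (x ℚ.- t ℚ.* C n) (G n ℤ.- + c) → c ≤ c₀ → VG t z → ℤ.∣ z ∣ ≤ s →
          Close (L n) (E n) 1 x (C n ℚ.* t)
        close-X n {x} {t} {c} {z} X c≤ T z≤ = Close-single
          (subst (λ y → VG y (ℤ.- L n)) (lem₂ x (C n ℚ.* t)) (VG-+ (VG-mono (-L≤E n) diff) Ct))
          Ct diff
          where
          lem₁ : ∀ x t c → x ℚ.- t ℚ.* c ≡ x ℚ.- c ℚ.* t
          lem₁ = solve-∀ ℚ-ring
          lem₂ : ∀ x y → x ℚ.- y ℚ.+ y ≡ x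
          lem₂ = solve-∀ ℚ-ring
          Ct : VG (C n ℚ.* t) (ℤ.- L n)
          Ct = VG-mono (-L≤-K+z n z z≤) (VG-* (Val⇒VG (Val-C n)) T)
          diff : VG (x ℚ.- C n ℚ.* t) (E n)
          diff = subst (λ y → VG y (E n)) (lem₁ x t (C n)) (VG-mono (E≤ n c c≤) X)

        close-C : ∀ n → Close (L n) (E n) 1 (C n) (C n)
        close-C n = Close-single VC VC (subst (λ z → VG z (E n)) (sym (ℚ.+-inverseʳ (C n))) (VG-0 (E n)))
          where
          VC : VG (C n) (ℤ.- L n)
          VC = VG-mono (-L≤-K n) (Val⇒VG (Val-C n))

        -- The value of E - (D - 1) L: the terms d K_n cancel, and the loss `e` does not depend on
        -- n.
        exponent : ∀ n → E n ℤ.+ L n ℤ.- + D ℤ.* L n ≡ + (D ℕ.* n) ℤ.- + e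
        exponent n = trans (lem (+ d) (K n) (+ D ℤ.* + n) (+ c₀) (+ s))
          (cong₂ ℤ._-_ (sym (ℤ.pos-* D n)) (cong (λ z → + c₀ ℤ.+ z) (sym (ℤ.pos-* d (c₀ ℕ.+ s)))))
          where
          lem : ∀ d K m c s → d ℤ.* K ℤ.+ m ℤ.- c ℤ.+ (K ℤ.+ (c ℤ.+ s)) ℤ.- (1ℤ ℤ.+ d) ℤ.* (K ℤ.+ (c ℤ.+ s)) ≡
            m ℤ.- (c ℤ.+ d ℤ.* (c ℤ.+ s))
          lem = ℤ.solve-∀

      -- h n is close to H (C α) (C β) C = M C^D F(α, β) = 0.
      VG-h : ∀ n → N ≤ n → VG (h n) (+ (D ℕ.* n) ℤ.- + e)
      VG-h n N≤n = subst (VG (h n)) (exponent n) (ev-extract (ev-zip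
        (λ {m} u v → subst (λ z → VG z W) (lem (h n) (H (C n ℚ.* α m) (C n ℚ.* β m) (C n))) (VG-+ u v))
        (ev-zip (λ X Y → VG-H-diff F D degree M c-integer X Y (close-C n))
          (ev-zip (λ X T → close-X n X (ℕ.m≤m+n cA cB) T (ℕ.m≤m+n _ _))
            (proj₂ A-growth n N≤n) (proj₂ α-bounded))
          (ev-zip (λ X T → close-X n X (ℕ.m≤n+m cB cA) T (ℕ.m≤n+m _ _))
            (proj₂ B-growth n N≤n) (proj₂ β-bounded)))
        (ev-map (λ {m} → subst (λ z → VG z W)
            (trans (ℚ.*-comm (evalSeq F α β m) k) (sym (H-homogeneous (C n) (α m) (β m)))))
          (Tiny-*-Bounded {evalSeq F α β} {const k} F-tiny (Bounded-const k) W))))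
        where
        W = E n ℤ.+ L n ℤ.- + D ℤ.* L n
        k = ι M ℚ.* pow (C n) D
        lem : ∀ x y → x ℚ.- y ℚ.+ y ≡ x
        lem = solve-∀ ℚ-ring

      private
        k₀ : ℚ
        k₀ = 1ℚ ℚ.+ (ℚ.∣ a 0 ∣ ℚ.+ ℚ.∣ b 0 ∣)

        0≤∣a∣ = ℚ.0≤∣p∣ (a 0)
        0≤∣b∣ = ℚ.0≤∣p∣ (b 0)

        1≤k₀ : 1ℚ ℚ.≤ k₀
        1≤k₀ = x≤x+y 1ℚ (ℚ.∣ a 0 ∣ ℚ.+ ℚ.∣ b 0 ∣) (0≤+ 0≤∣a∣ 0≤∣b∣)

        0≤k₀ : 0ℚ ℚ.≤ k₀
        0≤k₀ = ℚ.≤-trans 0≤1 1≤k₀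

        ∣a₀∣≤k₀ : ℚ.∣ a 0 ∣ ℚ.≤ k₀
        ∣a₀∣≤k₀ = ℚ.≤-trans (x≤x+y ℚ.∣ a 0 ∣ ℚ.∣ b 0 ∣ 0≤∣b∣) (x≤y+x (ℚ.∣ a 0 ∣ ℚ.+ ℚ.∣ b 0 ∣) 1ℚ 0≤1)

        ∣b₀∣≤k₀ : ℚ.∣ b 0 ∣ ℚ.≤ k₀
        ∣b₀∣≤k₀ = ℚ.≤-trans (x≤y+x ℚ.∣ b 0 ∣ ℚ.∣ a 0 ∣ 0≤∣a∣) (x≤y+x (ℚ.∣ a 0 ∣ ℚ.+ ℚ.∣ b 0 ∣) 1ℚ 0≤1)

        Λ : ℕ → ℚ
        Λ n = pow ℓ (suc (suc n)) ℚ.* k₀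

        ∣X∣≤Λ : ∀ {x₂ x₁ x₀} → ℚ.∣ x₂ ∣ ℚ.≤ k₀ → ℚ.∣ x₁ ∣ ℚ.≤ k₀ → ℚ.∣ x₀ ∣ ℚ.≤ k₀ →
          ∀ n → ℚ.∣ third (trip x₂ x₁ x₀ a b n) ∣ ℚ.≤ Λ n
        ∣X∣≤Λ X₂ X₁ X₀ n = proj₂ (proj₂ (∣trip∣≤ (λ k → ∣s∣≤P/2 (αs k) (a-s k)) (λ k → ∣s∣≤P/2 (βs k) (b-s k)) X₂ X₁ X₀ n))

        S k₁ : ℚ
        S  = sumTo (bound F) (λ i → sumTo (bound F) λ j → ℚ.∣ c i j ∣)
        -- Collects all that is independent of n. The factor P^e lifts the lower bound p^(D n - e)
        -- to p^(D n).
        k₁ = pow (ℓ ℚ.* ℓ ℚ.* k₀) D ℚ.* S ℚ.* pow P e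

        ∣h∣≤ : ∀ n → ℚ.∣ h n ∣ ℚ.* pow P e ℚ.≤ k₁ ℚ.* pow ℓ (D ℕ.* n)
        ∣h∣≤ n = subst (ℚ.∣ h n ∣ ℚ.* pow P e ℚ.≤_) eq
          (ℚ.*-monoʳ-≤-nonNeg (pow P e) {{ℚ.nonNegative (0≤pow 0≤P e)}}
            (∣H∣≤ F D degree M (∣X∣≤Λ 0≤k₀ 1≤k₀ ∣a₀∣≤k₀ n) (∣X∣≤Λ 1≤k₀ 0≤k₀ ∣b₀∣≤k₀ n) (∣X∣≤Λ 0≤k₀ 0≤k₀ 1≤k₀ n)))
          where
          lem₁ : ∀ l w k → l ℚ.* (l ℚ.* w) ℚ.* k ≡ l ℚ.* l ℚ.* k ℚ.* w
          lem₁ = solve-∀ ℚ-ring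
          lem₂ : ∀ q w S P → q ℚ.* w ℚ.* S ℚ.* P ≡ q ℚ.* S ℚ.* P ℚ.* w
          lem₂ = solve-∀ ℚ-ring
          eq : pow (Λ n) D ℚ.* S ℚ.* pow P e ≡ k₁ ℚ.* pow ℓ (D ℕ.* n)
          eq = trans (cong (λ z → z ℚ.* S ℚ.* pow P e)
              (trans (cong (λ z → pow z D) (lem₁ ℓ (pow ℓ n) k₀))
                (trans (pow-* (ℓ ℚ.* ℓ ℚ.* k₀) (pow ℓ n) D) (cong (pow (ℓ ℚ.* ℓ ℚ.* k₀) D ℚ.*_) (pow-pow ℓ D n)))))
            (lem₂ (pow (ℓ ℚ.* ℓ ℚ.* k₀) D) (pow ℓ (D ℕ.* n)) S (pow P e))

        PInt-h : ∀ n → PInt (h n)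
        PInt-h n = PInt-sumTo (bound F) λ i → PInt-sumTo (bound F) λ j →
          PInt-* (subst PInt (sym (proj₂ (c-integer i j))) (PInt-ι (proj₁ (c-integer i j))))
            (PInt-* (PInt-* (PInt-pow (PInt-X (PInt-ι 0ℤ) (PInt-ι 1ℤ) (PInt-s (αs 0) (a-s 0)) n) i)
                            (PInt-pow (PInt-X (PInt-ι 1ℤ) (PInt-ι 0ℤ) (PInt-s (βs 0) (b-s 0)) n) j))
                    (PInt-pow (PInt-X (PInt-ι 0ℤ) (PInt-ι 0ℤ) (PInt-ι 1ℤ) n) (D ℕ.∸ (i ℕ.+ j))))

        t₀ : ℕ
        t₀ = proj₁ (pow-P-dominates k₁)

      h≡0 : ∀ n → N ℕ.+ t₀ ≤ n → h n ≡ 0ℚ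
      h≡0 n N+t₀≤n = decidable-stable (h n ℚ.≟ 0ℚ) λ h≢0 →
        proj₂ (pow-P-dominates k₁) (D ℕ.* n)
          -- Domination is applied at exponent D n, which is n + d n by computation and hence at
          -- least t₀.
          (ℕ.≤-trans (ℕ.m≤n+m t₀ N) (ℕ.≤-trans N+t₀≤n (ℕ.m≤m+n n (d ℕ.* n))))
          (ℚ.≤-trans (subst (ℚ._≤ ℚ.∣ h n ∣ ℚ.* pow P e) zp-eq
              (ℚ.*-monoʳ-≤-nonNeg (pow P e) {{ℚ.nonNegative (0≤pow 0≤P e)}}
                (zp≤∣∣ (PInt-h n) (VG-h n (ℕ.≤-trans (ℕ.m≤m+n N t₀) N+t₀≤n)) h≢0)))
            (∣h∣≤ n))
        where
        lem : ∀ x y → x ℤ.- y ℤ.+ y ≡ x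
        lem = ℤ.solve-∀
        zp-eq : zp (+ (D ℕ.* n) ℤ.- + e) ℚ.* pow P e ≡ pow P (D ℕ.* n)
        zp-eq = trans (sym (zp-+ (+ (D ℕ.* n) ℤ.- + e) (+ e))) (cong zp (lem (+ (D ℕ.* n)) (+ e)))

      F[Q]≡0 : ∃ λ N′ → ∀ n → N′ ≤ n → evalℚ F (Qα a b n) (Qβ a b n) ≡ 0ℚ
      F[Q]≡0 = N ℕ.+ t₀ , λ n N′≤n → *-cancelˡ-≢0 (*≢0 ιM≢0 (pow≢0 (Val⇒≢0 (Val-C n)) D))
        (trans (sym (H-homogeneous (C n) (Qα a b n) (Qβ a b n)))
          (trans (cong₂ (λ x y → H x y (C n)) (C*Q n (A n)) (C*Q n (B n)))
            (trans (h≡0 n N′≤n) (sym (ℚ.*-zeroʳ (ι M ℚ.* pow (C n) D))))))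
        where
        ιM≢0 : ι M ≢ 0ℚ
        ιM≢0 = M≢0 ∘ ι-injective
        lem : ∀ c x i → c ℚ.* (x ℚ.* i) ≡ c ℚ.* i ℚ.* x
        lem = solve-∀ ℚ-ring
        C*Q : ∀ n x → C n ℚ.* (x ℚ.* inv (C n)) ≡ x
        C*Q n x = trans (lem (C n) x (inv (C n)))
          (trans (cong (ℚ._* x) (inv-inverseʳ (Val⇒≢0 (Val-C n)))) (ℚ.*-identityˡ x))

theorem22 : (p : ℕ) → Prime p → ¬ (p ≡ 2) →
    (α β : Seq) → IsCauchy p α → IsCauchy p β →
    (F : Poly) (D : ℕ) → NonZeroPoly F → TotalDegree F D →
    evalSeq F α β ≈[ p ] const 0ℚ →
    (∀ (G : Poly) (D′ : ℕ) → NonZeroPoly G → TotalDegree G D′ →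
    evalSeq G α β ≈[ p ] const 0ℚ → D ≤ D′) →
    (a b : ℕ → ℚ) (αs βs : ℕ → Seq) → IsMCF p α β a b αs βs →
    (∃ λ N → ∀ n → N ≤ n →
    ((+ D ℤ.- + 1) ℤ.* (kk p a (suc (suc n)) ℤ.+ kk p a (suc n)) ℤ.+ (+ 2) ℤ.* (+ D)
    ℤ.≤ kk p a (suc (suc (suc n))))
    × ValGe p (b (suc (suc (suc n))) ℚ.* inv (a (suc (suc (suc n)))))
    ((+ D ℤ.- + 1) ℤ.* kk p a (suc (suc n)) ℤ.+ + D)) →
    ∃ λ N → ∀ n → N ≤ n → evalℚ F (Qα a b n) (Qβ a b n) ≡ 0ℚ
theorem22 p pr p≢2 α β _ _ F zero _ (_ , degree) F≈0 _ a b αs βs mcf _ =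
  0 , λ n _ → constant-case degree (Qα a b n) (Qβ a b n)
  where open Expansion.Vanishing p pr α β a b αs βs mcf p≢2 F F≈0
-- For D = `suc d` the integer `+ D ℤ.- + 1` computes to `+ d`, so the growth bounds fit as they
-- stand.
theorem22 p pr p≢2 α β _ _ F (suc d) _ (_ , degree) F≈0 _ a b αs βs mcf (N , growth) =
  Positive-degree.F[Q]≡0 d N degree (λ n N≤n → proj₁ (growth n N≤n))
    (λ n N≤n → ValGe⇒VG (proj₂ (growth n N≤n))) (proj₁ M) (proj₁ (proj₂ M)) (proj₂ (proj₂ M))
  where
  open Valuation p pr
  open Expansion.Vanishing p pr α β a b αs βs mcf p≢2 F F≈0
  M = common-denominator F
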